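{- Fix an integer $m\ge2$. Let $\mathcal T_n$ be the largest number of vertices of a recursive tree contained in $G_m^n$. Then (i) $\liminf_{n\to\infty}\mathbb P(\mathcal T_n=n)>0$, i.e. with probability bounded away from $0$ the graph $G_m^n$ contains a spanning recursive tree; (ii) with high probability $\mathcal T_n$ is of order $n$, in the following sense: for every integer-valued $\omega=\omega(n)\to\infty$ (however slowly) with $\omega=o(n)$, with probability tending to $1$ as $n\to\infty$ one has $\mathcal T_n\ge(1-o(1))\frac{n}{\omega}$.
   Context: The Bollobás–Riordan preferential attachment multigraph $G_m^n$: $G_1^1$ is a single vertex $1$ with a loop (a loop contributes $2$ to the degree); given $G_1^{t-1}$ on $[t-1]$, vertex $t$ is added together with one edge, which joins $t$ to $s\in[t-1]$ with probability $\deg_{G_1^{t-1}}(s)/(2t-1)$ and is a loop at $t$ with probability $1/(2t-1)$. $G_m^n$ is obtained from $G_1^{mn}$ by merging vertices $m(j-1)+1,\dots,mj$ into a single vertex $j$, $j=1,\dots,n$ (keeping multiple edges and loops). A recursive tree in $G_m^n$ is a subgraph that is a tree rooted at its smallest vertex such that vertex labels increase along every path going away from the root. -}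

module Defs where

open import Level using (Level)
open import Data.Empty using (⊥)
open import Data.Unit using (⊤; tt)
open import Data.Nat as ℕ using (ℕ; zero; suc; z≤n; s≤s)
open import Data.Nat.ListAction using (sum)
open import Data.Integer as ℤ using (ℤ; +_; -[1+_]; +[1+_])
open import Data.Rational as ℚ using (ℚ; 0ℚ; 1ℚ)
open import Data.Fin as Fin using (Fin; zero; suc; fromℕ; inject₁; quotient)
import Data.Fin.Properties as Finₚ
open import Data.Fin.Subset using (Subset; _∈_; ∣_∣)
open import Data.Fin.Subset.Properties using (_∈?_; anySubset?)
open import Data.List using (List; []; _∷_; map; concatMap; foldr; length; lookup; allFin)
open import Data.List.Properties using (length-map)
open import Data.List.Membership.Propositional.Properties using (∈-lookup)
import Data.List.Relation.Unary.All as All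
open import Data.List.Relation.Unary.AllPairs using ([]; _∷_)
open import Data.List.Relation.Unary.Linked using (Linked; linked?)
open import Data.List.Relation.Unary.Unique.Propositional using (Unique)
import Data.List.Relation.Unary.Unique.DecPropositional as DecUnique
open import Data.Product using (∃-syntax; _×_; _,_; proj₁; proj₂)
import Data.Product as Product
open import Data.Product.Properties using (≡-dec)
open import Data.Sum using (_⊎_; inj₁; inj₂)
open import Function using (_∘_)
open import Relation.Nullary using (¬_; Dec; yes; no; contradiction)
open import Relation.Nullary.Decidable using (map′; ¬?; _×-dec_; _⊎-dec_; _→-dec_; decidable-stable; does)
open import Data.Bool using (if_then_else_)
open import Relation.Unary using (Pred; Decidable)
open import Relation.Binary.PropositionalEquality using (_≡_; refl; sym; cong; subst)

private variable
  a p : Level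
  A B : Set a
  n : ℕ

-- Limits of sequences

EventuallyAll : (ℕ → Set) → Set
EventuallyAll P = ∃[ N ] (∀ n → N ℕ.≤ n → P n)

_⟶_ : (ℕ → ℚ) → ℚ → Set
x ⟶ l = ∀ δ → 0ℚ ℚ.< δ → EventuallyAll λ n → ℚ.∣ x n ℚ.- l ∣ ℚ.< δ

-- liminf x = sup_N inf_{n ≥ N} x n is positive iff some tail of x is bounded
-- below by a positive constant, which may be taken rational.
LiminfPositive : (ℕ → ℚ) → Set
LiminfPositive x = ∃[ c ] (0ℚ ℚ.< c × EventuallyAll λ n → c ℚ.≤ x n)

TendsTo∞ : (ℕ → ℤ) → Set
TendsTo∞ ω = ∀ K → EventuallyAll λ n → K ℤ.≤ ω n

-- ω(n) = o(n)
IsLittleO-n : (ℕ → ℤ) → Set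
IsLittleO-n ω = ∀ δ → 0ℚ ℚ.< δ →
  EventuallyAll λ n → ℚ.∣ ω n ℚ./ 1 ∣ ℚ.≤ δ ℚ.* (+ n ℚ./ 1)

-- The quotient n / z as a total function, with n / 0 = 0.
ratio : ℕ → ℤ → ℚ
ratio n (+ zero)   = 0ℚ
ratio n +[1+ k ]   = + n ℚ./ suc k
ratio n (-[1+ k ]) = ℚ.- (+ n ℚ./ suc k)

-- Finitely supported distributions: lists of outcomes with their
-- probabilities, in which an outcome may occur several times.

Dist : Set a → Set a
Dist A = List (ℚ × A)

return : A → Dist A
return x = (1ℚ , x) ∷ []

mapDist : (A → B) → Dist A → Dist B
mapDist f = map (Product.map₂ f)

_>>=_ : Dist A → (A → Dist B) → Dist B
d >>= f = concatMap (λ (w , x) → map (Product.map₁ (w ℚ.*_)) (f x)) d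

Prob : {P : Pred A p} → Dist A → Decidable P → ℚ
Prob d P? = foldr (λ (w , x) s → if does (P? x) then w ℚ.+ s else s) 0ℚ d

-- A multigraph on Fin n is its list of edges; an edge with equal ends is a
-- loop.  The element i of Fin n stands for the vertex labelled i + 1.

Multigraph : ℕ → Set
Multigraph n = List (Fin n × Fin n)

-- A loop at v is counted twice.
deg : Multigraph n → Fin n → ℕ
deg g v = sum (map (λ (x , y) → at x ℕ.+ at y) g)
  where
  at : _ → ℕ
  at x = if does (x Finₚ.≟ v) then 1 else 0

relabel : ∀ {k} → (Fin n → Fin k) → Multigraph n → Multigraph k
relabel f = map (Product.map f f)

-- Adds the vertex labelled t + 1, which is fromℕ t, and one edge joining it to s.
extend : ∀ {t} → Multigraph t → Fin (suc t) → Multigraph (suc t)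
extend {t} g s = (fromℕ t , s) ∷ relabel inject₁ g

-- The arriving vertex is labelled t + 1, so the denominator is
-- 2 (t + 1) - 1 = 1 + 2 t.
attach : ∀ {t} → Multigraph t → Dist (Multigraph (suc t))
attach {t} g =
  (+ 1 ℚ./ suc (2 ℕ.* t) , extend g (fromℕ t)) ∷
  map (λ s → (+ deg g s ℚ./ suc (2 ℕ.* t) , extend g (inject₁ s))) (allFin t)

-- G₁ t is the law of G_1^t.  Starting from the empty graph, the first step
-- creates a loop at the first vertex with probability 1.
G₁ : (t : ℕ) → Dist (Multigraph t)
G₁ zero    = return []
G₁ (suc t) = G₁ t >>= attach

G₁-start : G₁ 1 ≡ return ((zero , zero) ∷ [])
G₁-start = refl

-- G m n is the law of G_m^n.  With labels shifted to start from 0, the block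
-- merged into j is {m j, …, m j + m - 1}, and quotient m sends i to ⌊i / m⌋.
G : (m n : ℕ) → Dist (Multigraph n)
G m n = mapDist (relabel (quotient m)) (G₁ (n ℕ.* m))

module _ (g : Multigraph n) where

  Edge : Set
  Edge = Fin (length g)

  Joins : Edge → Fin n → Fin n → Set
  Joins e u v = lookup g e ≡ (u , v) ⊎ lookup g e ≡ (v , u)

  record Subgraph : Set where
    constructor ⟨_,_⟩
    field
      V : Subset n
      E : Subset (length g)

  open Subgraph

  EndsIn : Subgraph → Set
  EndsIn h = ∀ e → e ∈ E h → proj₁ (lookup g e) ∈ V h × proj₂ (lookup g e) ∈ V h

  -- The walk u = v₀, e₁, v₁, …, e_k, v_k is given by u and the list of
  -- steps (e₁ , v₁), …, (e_k , v_k).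
  Steps : Set
  Steps = List (Edge × Fin n)

  vertices : Fin n → Steps → List (Fin n)
  vertices u ss = u ∷ map proj₂ ss

  end : Fin n → Steps → Fin n
  end u []             = u
  end u ((e , v) ∷ ss) = end v ss

  IsWalk : Subgraph → Fin n → Steps → Set
  IsWalk h u []             = u ∈ V h
  IsWalk h u ((e , v) ∷ ss) = u ∈ V h × e ∈ E h × Joins e u v × IsWalk h v ss

  IsPath : Subgraph → Fin n → Steps → Set
  IsPath h u ss = IsWalk h u ss × Unique (vertices u ss)

  NonEmpty : Steps → Set
  NonEmpty []      = ⊥
  NonEmpty (_ ∷ _) = ⊤

  -- A loop is a cycle of length 1, two parallel edges form one of length 2.
  IsCycle : Subgraph → Fin n → Steps → Set
  IsCycle h u ss = IsWalk h u ss × NonEmpty ss × end u ss ≡ u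
                 × Unique (map proj₁ ss) × Unique (map proj₂ ss)

  Connected : Subgraph → Set
  Connected h = ∀ u → u ∈ V h → ∀ v → v ∈ V h → ∃[ ss ] (IsPath h u ss × end u ss ≡ v)

  Acyclic : Subgraph → Set
  Acyclic h = ∀ u → ¬ (∃[ ss ] IsCycle h u ss)

  IsSmallest : Subgraph → Fin n → Set
  IsSmallest h r = r ∈ V h × (∀ v → v ∈ V h → r Fin.≤ v)

  -- In a tree the paths going away from r are those starting at r.
  IncreasingFrom : Subgraph → Fin n → Set
  IncreasingFrom h r = ∀ ss → IsPath h r ss → Linked Fin._<_ (vertices r ss)

  IsRecursiveTree : Subgraph → Set
  IsRecursiveTree h = EndsIn h × Connected h × Acyclic h
                    × (∃[ r ] (IsSmallest h r × IncreasingFrom h r))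

  HasRecursiveTree : ℕ → Set
  HasRecursiveTree k = ∃[ h ] (IsRecursiveTree h × ∣ V h ∣ ≡ k)

-- Recursive trees are decidable, since paths and cycles in a graph on n
-- vertices have at most n steps.

Unique⇒lookup-injective : {xs : List A} → Unique xs → ∀ {i j} → lookup xs i ≡ lookup xs j → i ≡ j
Unique⇒lookup-injective (_ ∷ _)  {zero}  {zero}  _  = refl
Unique⇒lookup-injective (x ∷ _)  {zero}  {suc j} eq = contradiction eq (All.lookup x (∈-lookup j))
Unique⇒lookup-injective (x ∷ _)  {suc i} {zero}  eq = contradiction (sym eq) (All.lookup x (∈-lookup i))
Unique⇒lookup-injective (_ ∷ xs) {suc i} {suc j} eq = cong suc (Unique⇒lookup-injective xs eq)

Unique⇒length≤ : {vs : List (Fin n)} → Unique vs → length vs ℕ.≤ n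
Unique⇒length≤ {vs = vs} uniq = Finₚ.injective⇒≤ {f = lookup vs} (Unique⇒lookup-injective uniq)

any≤? : ∀ {k l} {P : Pred (List (Fin k × Fin l)) p} → Decidable P →
        ∀ b → Dec (∃[ ss ] (length ss ℕ.≤ b × P ss))
any≤? P? zero = map′ (λ q → [] , z≤n , q) (λ { ([] , _ , q) → q }) (P? [])
any≤? P? (suc b) = map′
  (λ { (inj₁ q)                      → [] , z≤n , q
     ; (inj₂ (e , v , ss , ss≤b , q)) → (e , v) ∷ ss , s≤s ss≤b , q })
  (λ { ([] , _ , q)                      → inj₁ q
     ; ((e , v) ∷ ss , s≤s ss≤b , q) → inj₂ (e , v , ss , ss≤b , q) })
  (P? [] ⊎-dec Finₚ.any? λ e → Finₚ.any? λ v → any≤? (P? ∘ ((e , v) ∷_)) b)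

anyBounded? : ∀ {k l} {P : Pred (List (Fin k × Fin l)) p} → Decidable P →
              ∀ b → (∀ ss → P ss → length ss ℕ.≤ b) → Dec (∃[ ss ] P ss)
anyBounded? P? b bound = map′
  (λ (ss , _ , q) → ss , q) (λ (ss , q) → ss , bound ss q , q) (any≤? P? b)

module _ (g : Multigraph n) where

  open Subgraph

  isWalk? : ∀ h u ss → Dec (IsWalk g h u ss)
  isWalk? h u []             = u ∈? V h
  isWalk? h u ((e , v) ∷ ss) =
    u ∈? V h ×-dec e ∈? E h ×-dec
    (≡-dec Finₚ._≟_ Finₚ._≟_ _ _ ⊎-dec ≡-dec Finₚ._≟_ Finₚ._≟_ _ _) ×-dec
    isWalk? h v ss

  isPath? : ∀ h u ss → Dec (IsPath g h u ss)
  isPath? h u ss = isWalk? h u ss ×-dec DecUnique.unique? Finₚ._≟_ _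

  nonEmpty? : ∀ ss → Dec (NonEmpty g ss)
  nonEmpty? []      = no λ ()
  nonEmpty? (_ ∷ _) = yes tt

  isCycle? : ∀ h u ss → Dec (IsCycle g h u ss)
  isCycle? h u ss = isWalk? h u ss ×-dec nonEmpty? ss ×-dec end g u ss Finₚ.≟ u ×-dec
    DecUnique.unique? Finₚ._≟_ _ ×-dec DecUnique.unique? Finₚ._≟_ _

  steps≤ : (ss : Steps g) → Unique (map proj₂ ss) → length ss ℕ.≤ n
  steps≤ ss uniq = subst (ℕ._≤ n) (length-map proj₂ ss) (Unique⇒length≤ uniq)

  path≤ : ∀ h u ss → IsPath g h u ss → length ss ℕ.≤ n
  path≤ h u ss (_ , _ ∷ uniq) = steps≤ ss uniq

  cycle≤ : ∀ h u ss → IsCycle g h u ss → length ss ℕ.≤ n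
  cycle≤ h u ss (_ , _ , _ , _ , uniq) = steps≤ ss uniq

  increasingFrom? : ∀ h r → Dec (IncreasingFrom g h r)
  increasingFrom? h r = map′
    (λ none ss path → decidable-stable (incr? ss) λ ¬incr → none (ss , path , ¬incr))
    (λ all (ss , path , ¬incr) → ¬incr (all ss path))
    (¬? (anyBounded? (λ ss → isPath? h r ss ×-dec ¬? (incr? ss)) n
          λ ss (path , _) → path≤ h r ss path))
    where
    incr? : ∀ ss → Dec (Linked Fin._<_ (vertices g r ss))
    incr? ss = linked? Fin._<?_ _

  isRecursiveTree? : ∀ h → Dec (IsRecursiveTree g h)
  isRecursiveTree? h =
    Finₚ.all? (λ e → e ∈? E h →-dec (_ ∈? V h ×-dec _ ∈? V h)) ×-dec
    Finₚ.all? (λ u → u ∈? V h →-dec Finₚ.all? λ v → v ∈? V h →-dec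
      anyBounded? (λ ss → isPath? h u ss ×-dec end g u ss Finₚ.≟ v) n
        λ ss (path , _) → path≤ h u ss path) ×-dec
    Finₚ.all? (λ u → ¬? (anyBounded? (isCycle? h u) n (cycle≤ h u))) ×-dec
    Finₚ.any? (λ r →
      (r ∈? V h ×-dec Finₚ.all? λ v → v ∈? V h →-dec r Finₚ.≤? v) ×-dec
      increasingFrom? h r)

  hasRecursiveTree? : Decidable (HasRecursiveTree g)
  hasRecursiveTree? k = map′
    (λ (vs , es , q) → ⟨ vs , es ⟩ , q) (λ (h , q) → V h , E h , q)
    (anySubset? λ vs → anySubset? λ es →
      isRecursiveTree? ⟨ vs , es ⟩ ×-dec ∣ vs ∣ ℕ.≟ k)

-- The largest k ≤ b satisfying P, or 0 if there is none.
largest : {P : Pred ℕ p} → Decidable P → ℕ → ℕ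
largest P? zero    = zero
largest P? (suc b) = if does (P? (suc b)) then suc b else largest P? b

-- The number of vertices of a largest recursive tree in g; the search stops
-- at n because a subgraph has at most n vertices.
𝒯 : Multigraph n → ℕ
𝒯 {n} g = largest (hasRecursiveTree? g) n

{-# OPTIONS --safe #-}

-- Call block j the m vertices of G₁ merged into j (numbered from 0), and say
-- that it exits if one of its edges ends in a smaller block.  If all blocks from
-- w on exit, then choosing for each of them one such edge yields a spanning
-- forest of recursive trees rooted below w, and the largest tree has at least
-- n / w vertices.  The first two edges of block j both fail to leave it with
-- probability at most 3 / ((2 a + 1) (2 a + 3)) for a = j m, so m ≥ 2 makes
-- these probabilities summable: by telescoping, some block from w on fails to
-- exit with probability at most 1 / (2 w).  Part (i) is the case w = 1, part
-- (ii) the case w = ω n, with ε = 0.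
module Submission where

open import Defs
open import Algebra using (module CommutativeMonoid)
open import Data.Bool using (true; false; if_then_else_)
open import Data.Fin as Fin using (Fin; zero; suc; toℕ; fromℕ; fromℕ<; inject₁; quotient)
import Data.Fin.Induction as Finᵢ
import Data.Fin.Properties as Finₚ
open import Data.Fin.Subset using (Subset; _∈_; _⊆_; ∣_∣)
import Data.Fin.Subset.Properties as Subsetₚ
open import Data.Integer as ℤ using (ℤ; +_; +[1+_])
import Data.Integer.Properties as ℤₚ
open import Data.List using (List; []; _∷_; _++_; map; length; lookup; allFin; tabulate)
import Data.List.Membership.Propositional as List
import Data.List.Properties as Listₚ
open import Data.List.Relation.Unary.All as All using (All; []; _∷_)
import Data.List.Relation.Unary.All.Properties as Allₚ
open import Data.List.Relation.Unary.AllPairs using ([]; _∷_)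
import Data.List.Relation.Unary.AllPairs.Properties as AllPairsₚ
open import Data.List.Relation.Unary.Any as Any using (Any; here; there)
import Data.List.Relation.Unary.Any.Properties as Anyₚ
open import Data.List.Relation.Unary.Linked as Linked using (Linked; []; [-]; _∷_)
open import Data.List.Relation.Unary.Linked.Properties using (AllPairs⇒Linked)
open import Data.List.Relation.Unary.Unique.Propositional using (Unique)
open import Data.Nat as ℕ using (ℕ; zero; suc)
import Data.Nat.Induction as ℕᵢ
open import Data.Nat.ListAction using (sum)
import Data.Nat.Properties as ℕₚ
open import Data.Nat.Tactic.RingSolver using (solve-∀)
open import Data.Product using (∃-syntax; _×_; _,_; proj₁; proj₂)
import Data.Product as Product
open import Data.Product.Properties using (,-injective)
open import Data.Rational as ℚ using (ℚ; 0ℚ; 1ℚ)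
import Data.Rational.Properties as ℚₚ
open import Data.Rational.Unnormalised as ℚᵘ using (mkℚᵘ)
import Data.Rational.Unnormalised.Properties as ℚᵘₚ
open import Data.Sum using (_⊎_; inj₁; inj₂)
open import Data.Unit using (⊤; tt)
import Data.Vec as Vec
import Data.Vec.Properties as Vecₚ
open import Function using (_∘_; case_of_; id)
open import Induction.WellFounded using (Acc; acc)
open import Level using (Level)
open import Relation.Binary using (tri<; tri≈; tri>)
open import Relation.Binary.PropositionalEquality
open import Relation.Nullary using (¬_; Dec; yes; no; contradiction; recompute)
open import Relation.Nullary.Decidable using (does; dec-true; ¬?; _×-dec_; _→-dec_)
open import Relation.Unary using (Pred; Decidable)
open import Algebra.Properties.AbelianGroup ℚₚ.+-0-abelianGroup using (⁻¹-anti-homo‿-)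
open import Algebra.Properties.CommutativeMonoid.Sum ℕₚ.+-0-commutativeMonoid
  using (∑-comm; ∑-distrib-+; sum-cong-≗) renaming (sum to ∑)
open import Algebra.Properties.CommutativeSemigroup
  (CommutativeMonoid.commutativeSemigroup ℚₚ.+-0-commutativeMonoid) using (interchange; xy∙z≈xz∙y)

open Subgraph

private variable
  p : Level
  A B : Set
  k n t : ℕ

-- Counting on finite sets and a pigeonhole principle

𝟙 : {P : Set p} → Dec P → ℕ
𝟙 P? = if does P? then 1 else 0

largest-≤ : {P : Pred ℕ p} (P? : Decidable P) → ∀ b → largest P? b ℕ.≤ b
largest-≤ P? zero = ℕ.z≤n
largest-≤ P? (suc b) with P? (suc b)
... | yes _ = ℕₚ.≤-refl
... | no _  = ℕₚ.m≤n⇒m≤1+n (largest-≤ P? b)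

≤-largest : {P : Pred ℕ p} (P? : Decidable P) → ∀ {b k} → k ℕ.≤ b → P k → k ℕ.≤ largest P? b
≤-largest P? {zero} k≤b _ = k≤b
≤-largest P? {suc b} k≤b pk with P? (suc b)
... | yes _ = k≤b
... | no ¬p with ℕₚ.m≤n⇒m<n∨m≡n k≤b
...   | inj₁ (ℕ.s≤s k≤b′) = ≤-largest P? k≤b′ pk
...   | inj₂ refl         = contradiction pk ¬p

module _ {P : Pred (Fin n) p} (P? : Decidable P) where

  subset : Subset n
  subset = Vec.tabulate (does ∘ P?)

  ∈-subset⁺ : ∀ {x} → P x → x ∈ subset
  ∈-subset⁺ {x} px = Vecₚ.lookup⇒[]= x subset
    (trans (Vecₚ.lookup∘tabulate (does ∘ P?) x) (dec-true (P? x) px))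

  ∈-subset⁻ : ∀ {x} → x ∈ subset → P x
  ∈-subset⁻ {x} x∈
    with P? x | trans (sym (Vecₚ.lookup∘tabulate (does ∘ P?) x)) (Vecₚ.[]=⇒lookup x∈)
  ... | yes px | _ = px
  ... | no _   | ()

∣subset∣ : {P : Pred (Fin n) p} (P? : Decidable P) → ∣ subset P? ∣ ≡ ∑ (𝟙 ∘ P?)
∣subset∣ {n = zero} P? = refl
∣subset∣ {n = suc n} P? with P? zero
... | yes _ = cong suc (∣subset∣ (P? ∘ suc))
... | no _  = ∣subset∣ (P? ∘ suc)

∑-const-1 : ∀ n → ∑ {n} (λ _ → 1) ≡ n
∑-const-1 zero    = refl
∑-const-1 (suc n) = cong suc (∑-const-1 n)

∑-const-0 : ∀ n → ∑ {n} (λ _ → 0) ≡ 0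
∑-const-0 zero    = refl
∑-const-0 (suc n) = ∑-const-0 n

∑-indicator : (x : Fin n) → ∑ (λ i → 𝟙 (x Finₚ.≟ i)) ≡ 1
∑-indicator {suc n} zero = cong suc (∑-const-0 n)
∑-indicator {suc n} (suc x) = ∑-indicator x

-- The index found is one where `c` is maximal, and each of the `suc k` terms is at most that value.
∃-average : (c : Fin (suc k) → ℕ) → ∃[ i ] ∑ c ℕ.≤ suc k ℕ.* c i
∃-average {zero} c = zero , ℕₚ.≤-refl
∃-average {suc k} c with ∃-average (c ∘ suc)
... | i , ∑≤ with ℕₚ.≤-total (c zero) (c (suc i))
...   | inj₁ c0≤ = suc i , ℕₚ.+-mono-≤ c0≤ ∑≤
...   | inj₂ ≤c0 = zero , ℕₚ.+-monoʳ-≤ (c zero) (ℕₚ.≤-trans ∑≤ (ℕₚ.*-monoʳ-≤ (suc k) ≤c0))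

-- Double counting: every `j` lies in exactly one fibre, so the fibre sizes add up to `n` and a
-- largest fibre is at least average.
∃-largeFibre : (f : Fin n → Fin (suc k)) →
               ∃[ i ] n ℕ.≤ suc k ℕ.* ∣ subset (λ j → f j Finₚ.≟ i) ∣
∃-largeFibre {n} {k} f with ∃-average (λ i → ∣ subset (λ j → f j Finₚ.≟ i) ∣)
... | i , ∑≤ = i , ℕₚ.≤-trans (ℕₚ.≤-reflexive (sym ∑≡n)) ∑≤
  where
  open ≡-Reasoning
  ∑≡n : ∑ (λ i → ∣ subset (λ j → f j Finₚ.≟ i) ∣) ≡ n
  ∑≡n = begin
    ∑ (λ i → ∣ subset (λ j → f j Finₚ.≟ i) ∣)  ≡⟨ sum-cong-≗ (λ i → ∣subset∣ (λ j → f j Finₚ.≟ i)) ⟩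
    ∑ (λ i → ∑ (λ j → 𝟙 (f j Finₚ.≟ i)))       ≡⟨ ∑-comm (λ i j → 𝟙 (f j Finₚ.≟ i)) ⟩
    ∑ (λ j → ∑ (λ i → 𝟙 (f j Finₚ.≟ i)))       ≡⟨ sum-cong-≗ (λ j → ∑-indicator (f j)) ⟩
    ∑ {n} (λ _ → 1)                            ≡⟨ ∑-const-1 n ⟩
    n                                          ∎

-- Walks

module _ (g : Multigraph n) where

  IsWalk-∷ʳ : ∀ h {u e v} ss → IsWalk g h u ss → e ∈ E h → Joins g e (end g u ss) v → v ∈ V h →
              IsWalk g h u (ss ++ (e , v) ∷ [])
  IsWalk-∷ʳ h [] u∈ e∈ joins v∈ = u∈ , e∈ , joins , v∈
  IsWalk-∷ʳ h (_ ∷ ss) (u∈ , e′∈ , joins′ , walk) e∈ joins v∈ =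
    u∈ , e′∈ , joins′ , IsWalk-∷ʳ h ss walk e∈ joins v∈

  end-∷ʳ : ∀ {u e v} ss → end g u (ss ++ (e , v) ∷ []) ≡ v
  end-∷ʳ []       = refl
  end-∷ʳ (_ ∷ ss) = end-∷ʳ ss

  vertices-∷ʳ : ∀ {u e v} ss → vertices g u (ss ++ (e , v) ∷ []) ≡ vertices g u ss ++ v ∷ []
  vertices-∷ʳ []       = refl
  vertices-∷ʳ {u} (_ ∷ ss) = cong (u ∷_) (vertices-∷ʳ ss)

  -- An edge has only two ends, so traversing it twice in a row leads back, unless it is a loop.
  Joins-unique : ∀ {e u v x} → Joins g e u v → Joins g e v x → u ≡ v ⊎ u ≡ x
  Joins-unique (inj₁ p) (inj₁ q) = inj₁ (proj₁ (,-injective (trans (sym p) q)))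
  Joins-unique (inj₁ p) (inj₂ q) = inj₂ (proj₁ (,-injective (trans (sym p) q)))
  Joins-unique (inj₂ p) (inj₁ q) = inj₂ (proj₂ (,-injective (trans (sym p) q)))
  Joins-unique (inj₂ p) (inj₂ q) = inj₁ (proj₂ (,-injective (trans (sym p) q)))

  -- Repeating an edge at once would revisit `u` or use a loop at `u`, and the vertices of a path
  -- are distinct. This absence of immediate reversals is all that the monotonicity of tree paths
  -- needs.
  path-edges-≢ : ∀ h u ss → IsPath g h u ss → Linked _≢_ (map proj₁ ss)
  path-edges-≢ h u [] _ = []
  path-edges-≢ h u (_ ∷ []) _ = [-]
  path-edges-≢ h u ((e , v) ∷ (e′ , x) ∷ ss)
    ((_ , _ , joins , walk@(_ , _ , joins′ , _)) , (u≢v ∷ u≢x ∷ _) ∷ uniq) =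
    (λ { refl → case Joins-unique joins joins′ of λ { (inj₁ u≡v) → u≢v u≡v ; (inj₂ u≡x) → u≢x u≡x } })
    ∷ path-edges-≢ h v ((e′ , x) ∷ ss) (walk , uniq)

  increasing⇒≤end : ∀ u ss → Linked Fin._<_ (vertices g u ss) → u Fin.≤ end g u ss
  increasing⇒≤end u [] _ = ℕₚ.≤-refl
  increasing⇒≤end u ((_ , v) ∷ ss) (u<v ∷ incr) = ℕₚ.<⇒≤ (ℕₚ.<-≤-trans u<v (increasing⇒≤end v ss incr))

-- The spanning forest of parent edges

-- The argument of type w ≤ j is irrelevant so that parents do not depend on it.
module Forest (g : Multigraph n) (w : ℕ)
  (parentEdge : ∀ j → .(w ℕ.≤ toℕ j) → ∃[ e ] ∃[ u ] (lookup g e ≡ (j , u) × u Fin.< j)) where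

  edge : ∀ j → .(w ℕ.≤ toℕ j) → Edge g
  edge j q = proj₁ (parentEdge j q)

  parent : ∀ j → .(w ℕ.≤ toℕ j) → Fin n
  parent j q = proj₁ (proj₂ (parentEdge j q))

  lookup-edge : ∀ j .(q : w ℕ.≤ toℕ j) → lookup g (edge j q) ≡ (j , parent j q)
  lookup-edge j q = proj₁ (proj₂ (proj₂ (parentEdge j q)))

  parent-< : ∀ j .(q : w ℕ.≤ toℕ j) → parent j q Fin.< j
  parent-< j q = proj₂ (proj₂ (proj₂ (parentEdge j q)))

  -- The chain of parents from the second argument up to its first vertex below `w`. As a relation
  -- it allows uniqueness of roots to be proved by matching on two chains.
  data Root (r : Fin n) : Fin n → Set where
    base : toℕ r ℕ.< w → Root r r
    step : ∀ {j} (q : w ℕ.≤ toℕ j) → Root r (parent j q) → Root r j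

  Root-<w : ∀ {r j} → Root r j → toℕ r ℕ.< w
  Root-<w (base r<w) = r<w
  Root-<w (step _ R) = Root-<w R

  Root-≤ : ∀ {r j} → Root r j → r Fin.≤ j
  Root-≤ (base _)       = ℕₚ.≤-refl
  Root-≤ {j = j} (step q R) = ℕₚ.<⇒≤ (ℕₚ.≤-<-trans (Root-≤ R) (parent-< j q))

  Root-unique : ∀ {r r′ j} → Root r j → Root r′ j → r ≡ r′
  Root-unique (base _)   (base _)    = refl
  Root-unique (base r<w) (step q _)  = contradiction q (ℕₚ.<⇒≱ r<w)
  Root-unique (step q _) (base r<w)  = contradiction q (ℕₚ.<⇒≱ r<w)
  Root-unique (step _ R) (step _ R′) = Root-unique R R′

  -- Any two roots of a vertex agree by `Root-unique`, so the well-founded recursion never has to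
  -- unfold.
  abstract
    findRoot : ∀ j → ∃[ r ] Root r j
    findRoot j = go j (Finᵢ.<-wellFounded j)
      where
      go : ∀ j → Acc Fin._<_ j → ∃[ r ] Root r j
      go j (acc rec) with w ℕ.≤? toℕ j
      ... | yes q = let r , R = go (parent j q) (rec (parent-< j q)) in r , step q R
      ... | no ¬q = j , base (ℕₚ.≰⇒> ¬q)

  root : Fin n → Fin n
  root j = proj₁ (findRoot j)

  isRoot : ∀ j → Root (root j) j
  isRoot j = proj₂ (findRoot j)

  -- Each class of vertices with a common root is therefore closed under taking parents, and can
  -- serve as the vertex set of a tree.
  root-parent : ∀ j (q : w ℕ.≤ toℕ j) → root (parent j q) ≡ root j
  root-parent j q = Root-unique (step q (isRoot (parent j q))) (isRoot j)

  module Tree (r : Fin n) (r<w : toℕ r ℕ.< w) where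

    InV : Fin n → Set
    InV j = root j ≡ r

    InV? : Decidable InV
    InV? j = root j Finₚ.≟ r

    InE : Edge g → Set
    InE e = ∃[ j ] ∃[ q ] (InV j × edge j q ≡ e)

    InE? : Decidable InE
    InE? e = Finₚ.any? λ j → dec j
      where
      dec : ∀ j → Dec (∃[ q ] (InV j × edge j q ≡ e))
      dec j with w ℕ.≤? toℕ j
      ... | no ¬q = no (¬q ∘ proj₁)
      ... | yes q with InV? j | edge j q Finₚ.≟ e
      ...   | yes v | yes eq = yes (q , v , eq)
      ...   | no ¬v | _      = no (¬v ∘ proj₁ ∘ proj₂)
      ...   | yes _ | no ¬eq = no (¬eq ∘ proj₂ ∘ proj₂)

    tree : Subgraph g
    tree = ⟨ subset InV? , subset InE? ⟩

    -- The two ways of traversing a parent edge: from child to parent, or from parent to child. The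
    -- direction determines whether labels fall or rise.
    data Step (u : Fin n) (e : Edge g) (v : Fin n) : Set where
      down : (q : w ℕ.≤ toℕ u) → edge u q ≡ e → parent u q ≡ v → Step u e v
      up   : (q : w ℕ.≤ toℕ v) → edge v q ≡ e → parent v q ≡ u → Step u e v

    toStep : ∀ {u e v} → e ∈ E tree → Joins g e u v → Step u e v
    toStep e∈ joins with ∈-subset⁻ InE? e∈
    toStep e∈ (inj₁ eq) | j , q , _ , refl with ,-injective (trans (sym (lookup-edge j q)) eq)
    ... | refl , eq′ = down q refl eq′
    toStep e∈ (inj₂ eq) | j , q , _ , refl with ,-injective (trans (sym (lookup-edge j q)) eq)
    ... | refl , eq′ = up q refl eq′

    endsIn : EndsIn g tree
    endsIn e e∈ with ∈-subset⁻ InE? e∈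
    ... | j , q , v , refl =
      subst (λ (x , y) → x ∈ V tree × y ∈ V tree) (sym (lookup-edge j q))
        (∈-subset⁺ InV? v , ∈-subset⁺ InV? (trans (root-parent j q) v))

    edge-∈ : ∀ {j} (q : w ℕ.≤ toℕ j) → InV j → edge j q ∈ E tree
    edge-∈ q v = ∈-subset⁺ InE? (_ , q , v , refl)

    -- A vertex below `w` is its own root, and the root is the smallest vertex of its class; hence a
    -- vertex with a smaller one in its class has a parent.
    nonRoot : ∀ {u v} → InV u → InV v → v Fin.< u → w ℕ.≤ toℕ u
    nonRoot {u} {v} ru rv v<u with w ℕ.≤? toℕ u
    ... | yes q = q
    ... | no ¬q = contradiction u≤v (ℕₚ.<⇒≱ v<u)
      where
      u≤v : u Fin.≤ v
      u≤v = subst (Fin._≤ v)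
        (trans rv (trans (sym ru) (Root-unique (isRoot u) (base (ℕₚ.≰⇒> ¬q)))))
        (Root-≤ (isRoot v))

    -- The larger end of the path is linked to the rest by its parent edge, so
    -- the rest of the path stays below it.
    path : ∀ {b} → Acc ℕ._<_ b → ∀ {u v} → InV u → InV v → toℕ u ℕ.< b → toℕ v ℕ.< b →
           ∃[ ss ] (IsPath g tree u ss × end g u ss ≡ v × All (λ x → toℕ x ℕ.< b) (vertices g u ss))
    path (acc rec) {u} {v} ru rv u<b v<b with Finₚ.<-cmp u v
    ... | tri≈ _ refl _ = [] , (∈-subset⁺ InV? ru , [] ∷ []) , refl , u<b ∷ []
    ... | tri> _ _ v<u =
      let q = nonRoot ru rv v<u
          rp = trans (root-parent u q) ru
          ss , (walk , uniq) , end≡ , below = path (rec u<b) rp rv (parent-< u q) v<u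
      in (edge u q , parent u q) ∷ ss ,
         ((∈-subset⁺ InV? ru , edge-∈ q ru , inj₁ (lookup-edge u q) , walk) ,
          All.map (λ x<u u≡x → ℕₚ.<-irrefl (cong toℕ (sym u≡x)) x<u) below ∷ uniq) ,
         end≡ , u<b ∷ All.map (λ x<u → ℕₚ.<-trans x<u u<b) below
    ... | tri< u<v _ _ =
      let q = nonRoot rv ru u<v
          rp = trans (root-parent v q) rv
          ss , (walk , uniq) , end≡ , below = path (rec v<b) ru rp u<v (parent-< v q)
      in ss ++ (edge v q , v) ∷ [] ,
         (IsWalk-∷ʳ g tree ss walk (edge-∈ q rv)
            (subst (λ x → Joins g (edge v q) x v) (sym end≡) (inj₂ (lookup-edge v q))) (∈-subset⁺ InV? rv) ,
          subst Unique (sym (vertices-∷ʳ g ss)) (AllPairsₚ.++⁺ uniq ([] ∷ [])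
            (All.map (λ x<v → (λ x≡v → ℕₚ.<-irrefl (cong toℕ x≡v) x<v) ∷ []) below))) ,
         end-∷ʳ g ss ,
         subst (All _) (sym (vertices-∷ʳ g ss)) (Allₚ.++⁺ (All.map (λ x<v → ℕₚ.<-trans x<v v<b) below) (v<b ∷ []))
    -- The list of edges starts with the parent edge of `v`, as if the walk had just come up along
    -- it. The only way down from a vertex is its parent edge, so without immediate reversals the
    -- walk must go up again at every step.
    rising : ∀ {v} .(q : w ℕ.≤ toℕ v) ss → IsWalk g tree v ss → Linked _≢_ (edge v q ∷ map proj₁ ss) →
             Linked Fin._<_ (vertices g v ss)
    rising q [] _ _ = [-]
    rising q ((e , x) ∷ ss) (_ , e∈ , joins , walk) (≢e ∷ linked) with toStep e∈ joins
    ... | down _ refl _ = contradiction refl ≢e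
    ... | up q′ refl refl = parent-< x q′ ∷ rising q′ ss walk linked

    increasingFrom : IncreasingFrom g tree r
    increasingFrom [] _ = [-]
    increasingFrom ((e , v) ∷ ss) isPath@((_ , e∈ , joins , walk) , _) with toStep e∈ joins
    -- The root lies below `w` and has no parent edge, so the first step goes up.
    ... | down q _ _ = contradiction q (ℕₚ.<⇒≱ r<w)
    ... | up q refl refl = parent-< v q ∷
      rising q ss walk (path-edges-≢ g tree r _ isPath)

    -- An increasing walk in the tree enters each vertex through its parent edge, the last vertex
    -- included. Prepending the parent edge of `v` covers the empty walk.
    edge-end-∈ : ∀ {v u} .(q : w ℕ.≤ toℕ v) .(q′ : w ℕ.≤ toℕ u) ss → IsWalk g tree v ss →
                 Linked Fin._<_ (vertices g v ss) → end g v ss ≡ u →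
                 edge u q′ List.∈ edge v q ∷ map proj₁ ss
    edge-end-∈ q q′ [] _ _ refl = here refl
    edge-end-∈ q q′ ((e , x) ∷ ss) (_ , e∈ , joins , walk) (v<x ∷ incr) end≡ with toStep e∈ joins
    ... | down q″ refl refl = contradiction (parent-< _ q″) (ℕₚ.<-asym v<x)
    ... | up q″ refl refl = there (edge-end-∈ q″ q′ ss walk incr end≡)

    -- While it descends, the walk stays below `u`, so it must turn upwards at some point; from
    -- there on it rises and can reach `u` only through the parent edge of `u`.
    returning : ∀ {x u} .(q : w ℕ.≤ toℕ u) ss → x Fin.< u → IsWalk g tree x ss →
                Linked _≢_ (map proj₁ ss) → end g x ss ≡ u → edge u q List.∈ map proj₁ ss
    returning q [] x<u _ _ refl = contradiction x<u (ℕₚ.<-irrefl refl)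
    returning q ((e , y) ∷ ss) x<u (_ , e∈ , joins , walk) linked end≡ with toStep e∈ joins
    ... | down q′ refl refl =
      there (returning q ss (ℕₚ.<-trans (parent-< _ q′) x<u) walk (Linked.tail linked) end≡)
    ... | up q′ refl refl = edge-end-∈ q′ q ss walk (rising q′ ss walk linked) end≡

    -- A walk without immediate reversals descends first and then rises; if it
    -- comes back to u, it leaves and re-enters u along the parent edge of u.
    acyclic : Acyclic g tree
    acyclic u ([] , _ , () , _)
    acyclic u ((e , v) ∷ ss , (_ , e∈ , joins , walk) , _ , end≡ , uniq@(≢e ∷ uniq′) , _) with toStep e∈ joins
    ... | down q refl refl =
      All.lookup ≢e (returning q ss (parent-< u q) walk (AllPairs⇒Linked uniq′) end≡) refl
    -- If the first step goes up, the walk rises throughout and ends above `u` instead of at `u`.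
    ... | up q refl refl = ℕₚ.<-irrefl refl (ℕₚ.<-≤-trans (parent-< v q)
      (subst (v Fin.≤_) end≡ (increasing⇒≤end g v ss (rising q ss walk (AllPairs⇒Linked uniq)))))

    isRecursiveTree : InV r → IsRecursiveTree g tree
    isRecursiveTree r∈ = endsIn , connected , acyclic , r ,
      (∈-subset⁺ InV? r∈ , λ v v∈ → subst (Fin._≤ v) (∈-subset⁻ InV? v∈) (Root-≤ (isRoot v))) ,
      increasingFrom
      where
      connected : Connected g tree
      connected u u∈ v v∈ =
        let ss , isPath , end≡ , _ = path (ℕᵢ.<-wellFounded n)
              (∈-subset⁻ InV? u∈) (∈-subset⁻ InV? v∈) (Finₚ.toℕ<n u) (Finₚ.toℕ<n v)
        in ss , isPath , end≡

    ∣tree∣≤𝒯 : InV r → ∣ V tree ∣ ℕ.≤ 𝒯 g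
    ∣tree∣≤𝒯 r∈ = ≤-largest (hasRecursiveTree? g) (Subsetₚ.∣p∣≤n (V tree)) (tree , isRecursiveTree r∈ , refl)

  rootIndex : Fin n → Fin w
  rootIndex j = fromℕ< (Root-<w (isRoot j))

  rootIndex-injective : ∀ {i j} → rootIndex i ≡ rootIndex j → root i ≡ root j
  rootIndex-injective {i} {j} eq = Finₚ.toℕ-injective (begin
    toℕ (root i)       ≡⟨ Finₚ.toℕ-fromℕ< (Root-<w (isRoot i)) ⟨
    toℕ (rootIndex i)  ≡⟨ cong toℕ eq ⟩
    toℕ (rootIndex j)  ≡⟨ Finₚ.toℕ-fromℕ< (Root-<w (isRoot j)) ⟩
    toℕ (root j)       ∎)
    where open ≡-Reasoning

  root-idem : ∀ j → root (root j) ≡ root j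
  root-idem j = Root-unique (isRoot (root j)) (base (Root-<w (isRoot j)))

  InFibre? : ∀ i → Decidable (λ j → rootIndex j ≡ i)
  InFibre? i j = rootIndex j Finₚ.≟ i

  -- A nonempty fibre lies in the tree of the common root of its members. A fibre can be empty,
  -- since `w` may exceed `n`.
  ∣fibre∣≤𝒯 : ∀ i → ∣ subset (InFibre? i) ∣ ℕ.≤ 𝒯 g
  ∣fibre∣≤𝒯 i with Subsetₚ.nonempty? (subset (InFibre? i))
  ... | no empty = subst (ℕ._≤ 𝒯 g) (sym (trans (cong ∣_∣ (Subsetₚ.Empty-unique empty)) (Subsetₚ.∣⊥∣≡0 n))) ℕ.z≤n
  ... | yes (j , j∈) = ℕₚ.≤-trans (Subsetₚ.p⊆q⇒∣p∣≤∣q∣ fibre⊆V) (∣tree∣≤𝒯 (root-idem j))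
    where
    open Tree (root j) (Root-<w (isRoot j))
    fibre⊆V : subset (InFibre? i) ⊆ V tree
    fibre⊆V x∈ = ∈-subset⁺ InV?
      (rootIndex-injective (trans (∈-subset⁻ (InFibre? i) x∈) (sym (∈-subset⁻ (InFibre? i) j∈))))

n≤w*𝒯 : (g : Multigraph n) (w : ℕ) .{{_ : ℕ.NonZero w}} →
  (∀ j → w ℕ.≤ toℕ j → ∃[ e ] ∃[ u ] (lookup g e ≡ (j , u) × u Fin.< j)) → n ℕ.≤ w ℕ.* 𝒯 g
n≤w*𝒯 g (suc k) parentEdge =
  let i , n≤ = ∃-largeFibre rootIndex
  in ℕₚ.≤-trans n≤ (ℕₚ.*-monoʳ-≤ (suc k) (∣fibre∣≤𝒯 i))
  -- The irrelevant inequality is recovered by deciding it again.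
  where open Forest g (suc k) (λ j q → parentEdge j (recompute (suc k ℕ.≤? toℕ j) q))

-- Fractions

toℚᵘ-/ : ∀ i d .{{_ : ℕ.NonZero d}} → ℚ.toℚᵘ (i ℚ./ d) ℚᵘ.≃ (i ℚᵘ./ d)
toℚᵘ-/ i (suc d) = ℚₚ.toℚᵘ-fromℚᵘ (mkℚᵘ i d)

/-mono-≤ : ∀ {a b c d} .{{_ : ℕ.NonZero b}} .{{_ : ℕ.NonZero d}} → a ℕ.* d ℕ.≤ c ℕ.* b → + a ℚ./ b ℚ.≤ + c ℚ./ d
/-mono-≤ {a} {suc b} {c} {suc d} ad≤cb = ℚₚ.toℚᵘ-cancel-≤
  (ℚᵘₚ.≤-respˡ-≃ (ℚᵘₚ.≃-sym (toℚᵘ-/ (+ a) (suc b)))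
  (ℚᵘₚ.≤-respʳ-≃ (ℚᵘₚ.≃-sym (toℚᵘ-/ (+ c) (suc d)))
  (ℚᵘ.*≤* (subst₂ ℤ._≤_ (ℤₚ.pos-* a (suc d)) (ℤₚ.pos-* c (suc b)) (ℤ.+≤+ ad≤cb)))))

/-mono-< : ∀ {a b c d} .{{_ : ℕ.NonZero b}} .{{_ : ℕ.NonZero d}} → a ℕ.* d ℕ.< c ℕ.* b → + a ℚ./ b ℚ.< + c ℚ./ d
/-mono-< {a} {suc b} {c} {suc d} ad<cb = ℚₚ.toℚᵘ-cancel-<
  (ℚᵘₚ.<-respˡ-≃ (ℚᵘₚ.≃-sym (toℚᵘ-/ (+ a) (suc b)))
  (ℚᵘₚ.<-respʳ-≃ (ℚᵘₚ.≃-sym (toℚᵘ-/ (+ c) (suc d)))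
  (ℚᵘ.*<* (subst₂ ℤ._<_ (ℤₚ.pos-* a (suc d)) (ℤₚ.pos-* c (suc b)) (ℤ.+<+ ad<cb)))))

/-≡ : ∀ {a b c d} .{{_ : ℕ.NonZero b}} .{{_ : ℕ.NonZero d}} → a ℕ.* d ≡ c ℕ.* b → + a ℚ./ b ≡ + c ℚ./ d
/-≡ {a} {b} {c} {d} eq = ℚₚ.≤-antisym
  (/-mono-≤ {a} {b} {c} {d} (ℕₚ.≤-reflexive eq)) (/-mono-≤ {c} {d} {a} {b} (ℕₚ.≤-reflexive (sym eq)))

/-+ : ∀ a b c d → (+ a ℚ./ suc b) ℚ.+ (+ c ℚ./ suc d) ≡ + (a ℕ.* suc d ℕ.+ c ℕ.* suc b) ℚ./ (suc b ℕ.* suc d)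
/-+ a b c d = ℚₚ.toℚᵘ-injective (begin
  ℚ.toℚᵘ ((+ a ℚ./ suc b) ℚ.+ (+ c ℚ./ suc d))            ≈⟨ ℚₚ.toℚᵘ-homo-+ (+ a ℚ./ suc b) (+ c ℚ./ suc d) ⟩
  ℚ.toℚᵘ (+ a ℚ./ suc b) ℚᵘ.+ ℚ.toℚᵘ (+ c ℚ./ suc d)      ≈⟨ ℚᵘₚ.+-cong (toℚᵘ-/ (+ a) (suc b)) (toℚᵘ-/ (+ c) (suc d)) ⟩
  mkℚᵘ (+ a) b ℚᵘ.+ mkℚᵘ (+ c) d                          ≡⟨ cong (ℚᵘ._/ (suc b ℕ.* suc d)) num ⟩
  + (a ℕ.* suc d ℕ.+ c ℕ.* suc b) ℚᵘ./ (suc b ℕ.* suc d)  ≈⟨ toℚᵘ-/ (+ (a ℕ.* suc d ℕ.+ c ℕ.* suc b)) (suc b ℕ.* suc d) ⟨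
  ℚ.toℚᵘ (+ (a ℕ.* suc d ℕ.+ c ℕ.* suc b) ℚ./ (suc b ℕ.* suc d)) ∎)
  where
  open ℚᵘₚ.≃-Reasoning
  num : + a ℤ.* + suc d ℤ.+ + c ℤ.* + suc b ≡ + (a ℕ.* suc d ℕ.+ c ℕ.* suc b)
  num = trans (cong₂ ℤ._+_ (sym (ℤₚ.pos-* a (suc d))) (sym (ℤₚ.pos-* c (suc b)))) (sym (ℤₚ.pos-+ (a ℕ.* suc d) _))

/-* : ∀ a b c d → (+ a ℚ./ suc b) ℚ.* (+ c ℚ./ suc d) ≡ + (a ℕ.* c) ℚ./ (suc b ℕ.* suc d)
/-* a b c d = ℚₚ.toℚᵘ-injective (begin
  ℚ.toℚᵘ ((+ a ℚ./ suc b) ℚ.* (+ c ℚ./ suc d))            ≈⟨ ℚₚ.toℚᵘ-homo-* (+ a ℚ./ suc b) (+ c ℚ./ suc d) ⟩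
  ℚ.toℚᵘ (+ a ℚ./ suc b) ℚᵘ.* ℚ.toℚᵘ (+ c ℚ./ suc d)      ≈⟨ ℚᵘₚ.*-cong (toℚᵘ-/ (+ a) (suc b)) (toℚᵘ-/ (+ c) (suc d)) ⟩
  mkℚᵘ (+ a) b ℚᵘ.* mkℚᵘ (+ c) d                          ≡⟨ cong (ℚᵘ._/ (suc b ℕ.* suc d)) (sym (ℤₚ.pos-* a c)) ⟩
  + (a ℕ.* c) ℚᵘ./ (suc b ℕ.* suc d)                      ≈⟨ toℚᵘ-/ (+ (a ℕ.* c)) (suc b ℕ.* suc d) ⟨
  ℚ.toℚᵘ (+ (a ℕ.* c) ℚ./ (suc b ℕ.* suc d)) ∎)
  where open ℚᵘₚ.≃-Reasoning

0≤/ : ∀ a b .{{_ : ℕ.NonZero b}} → 0ℚ ℚ.≤ + a ℚ./ b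
0≤/ a b = ℚₚ.nonNegative⁻¹ (+ a ℚ./ b) {{ℚₚ.normalize-nonNeg a b}}

*-monoˡ : ∀ {r x y} → 0ℚ ℚ.≤ r → x ℚ.≤ y → r ℚ.* x ℚ.≤ r ℚ.* y
*-monoˡ {r} 0≤r = ℚₚ.*-monoˡ-≤-nonNeg r {{ℚ.nonNegative 0≤r}}

-- Expectation

𝔼 : Dist A → (A → ℚ) → ℚ
𝔼 []            f = 0ℚ
𝔼 ((w , x) ∷ d) f = w ℚ.* f x ℚ.+ 𝔼 d f

𝔼-++ : (d e : Dist A) (f : A → ℚ) → 𝔼 (d ++ e) f ≡ 𝔼 d f ℚ.+ 𝔼 e f
𝔼-++ []            e f = sym (ℚₚ.+-identityˡ (𝔼 e f))
𝔼-++ ((w , x) ∷ d) e f =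
  trans (cong (w ℚ.* f x ℚ.+_) (𝔼-++ d e f)) (sym (ℚₚ.+-assoc (w ℚ.* f x) (𝔼 d f) (𝔼 e f)))

𝔼-reweight : ∀ r (d : Dist A) (f : A → ℚ) → 𝔼 (map (Product.map₁ (r ℚ.*_)) d) f ≡ r ℚ.* 𝔼 d f
𝔼-reweight r []            f = sym (ℚₚ.*-zeroʳ r)
𝔼-reweight r ((w , x) ∷ d) f = trans
  (cong₂ ℚ._+_ (ℚₚ.*-assoc r w (f x)) (𝔼-reweight r d f))
  (sym (ℚₚ.*-distribˡ-+ r (w ℚ.* f x) (𝔼 d f)))

𝔼->>= : (d : Dist A) (f : A → Dist B) (h : B → ℚ) → 𝔼 (d >>= f) h ≡ 𝔼 d (λ x → 𝔼 (f x) h)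
𝔼->>= []            f h = refl
𝔼->>= ((w , x) ∷ d) f h = trans (𝔼-++ (map (Product.map₁ (w ℚ.*_)) (f x)) (d >>= f) h)
  (cong₂ ℚ._+_ (𝔼-reweight w (f x) h) (𝔼->>= d f h))

𝔼-mapDist : (φ : A → B) (d : Dist A) (f : B → ℚ) → 𝔼 (mapDist φ d) f ≡ 𝔼 d (f ∘ φ)
𝔼-mapDist φ []            f = refl
𝔼-mapDist φ ((w , x) ∷ d) f = cong (w ℚ.* f (φ x) ℚ.+_) (𝔼-mapDist φ d f)

𝔼-* : ∀ c (d : Dist A) (f : A → ℚ) → 𝔼 d (λ x → c ℚ.* f x) ≡ c ℚ.* 𝔼 d f
𝔼-* c []            f = sym (ℚₚ.*-zeroʳ c)
𝔼-* c ((w , x) ∷ d) f = begin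
  w ℚ.* (c ℚ.* f x) ℚ.+ 𝔼 d (λ x → c ℚ.* f x)  ≡⟨ cong₂ ℚ._+_ comm (𝔼-* c d f) ⟩
  c ℚ.* (w ℚ.* f x) ℚ.+ c ℚ.* 𝔼 d f            ≡⟨ ℚₚ.*-distribˡ-+ c (w ℚ.* f x) (𝔼 d f) ⟨
  c ℚ.* (w ℚ.* f x ℚ.+ 𝔼 d f)                  ∎
  where
  open ≡-Reasoning
  comm : w ℚ.* (c ℚ.* f x) ≡ c ℚ.* (w ℚ.* f x)
  comm = trans (sym (ℚₚ.*-assoc w c (f x))) (trans (cong (ℚ._* f x) (ℚₚ.*-comm w c)) (ℚₚ.*-assoc c w (f x)))

𝔼-+ : (d : Dist A) (f h : A → ℚ) → 𝔼 d (λ x → f x ℚ.+ h x) ≡ 𝔼 d f ℚ.+ 𝔼 d h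
𝔼-+ []            f h = refl
𝔼-+ ((w , x) ∷ d) f h = trans
  (cong₂ ℚ._+_ (ℚₚ.*-distribˡ-+ w (f x) (h x)) (𝔼-+ d f h))
  (interchange (w ℚ.* f x) (w ℚ.* h x) (𝔼 d f) (𝔼 d h))

indicator : {P : Set p} → Dec P → ℚ
indicator P? = if does P? then 1ℚ else 0ℚ

Prob≡𝔼 : {P : Pred A p} (d : Dist A) (P? : Decidable P) → Prob d P? ≡ 𝔼 d (indicator ∘ P?)
Prob≡𝔼 []            P? = refl
Prob≡𝔼 ((w , x) ∷ d) P? with does (P? x)
... | true  = cong₂ ℚ._+_ (sym (ℚₚ.*-identityʳ w)) (Prob≡𝔼 d P?)
... | false = trans (Prob≡𝔼 d P?) (sym (trans (cong (ℚ._+ 𝔼 d _) (ℚₚ.*-zeroʳ w)) (ℚₚ.+-identityˡ _)))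

0≤indicator : {P : Set p} (P? : Dec P) → 0ℚ ℚ.≤ indicator P?
0≤indicator (yes _) = 0≤/ 1 1
0≤indicator (no _)  = ℚₚ.≤-refl

indicator≤1 : {P : Set p} (P? : Dec P) → indicator P? ℚ.≤ 1ℚ
indicator≤1 (yes _) = ℚₚ.≤-refl
indicator≤1 (no _)  = 0≤/ 1 1

indicator-mono : ∀ {q} {P : Set p} {Q : Set q} (P? : Dec P) (Q? : Dec Q) → (P → Q) → indicator P? ℚ.≤ indicator Q?
indicator-mono (no _)   Q?       P⇒Q = 0≤indicator Q?
indicator-mono (yes px) (yes _)  P⇒Q = ℚₚ.≤-refl
indicator-mono (yes px) (no ¬q)  P⇒Q = contradiction (P⇒Q px) ¬q

-- A probability distribution whose listed outcomes all satisfy the invariant `Q`, so that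
-- integrands need only be compared where `Q` holds.
record Law (Q : A → Set) (d : Dist A) : Set where
  constructor law
  field
    support : All (λ (w , x) → 0ℚ ℚ.≤ w × Q x) d
    total   : 𝔼 d (λ _ → 1ℚ) ≡ 1ℚ

open Law

𝔼-mono : ∀ {Q : A → Set} {d : Dist A} {f h} → Law Q d → (∀ x → Q x → f x ℚ.≤ h x) → 𝔼 d f ℚ.≤ 𝔼 d h
𝔼-mono L f≤h = go (support L)
  where
  go : ∀ {d} → All _ d → 𝔼 d _ ℚ.≤ 𝔼 d _
  go [] = ℚₚ.≤-refl
  go ((0≤w , q) ∷ qs) = ℚₚ.+-mono-≤ (*-monoˡ 0≤w (f≤h _ q)) (go qs)

𝔼-const : ∀ {Q : A → Set} {d : Dist A} → Law Q d → ∀ c → 𝔼 d (λ _ → c) ≡ c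
𝔼-const {d = d} L c = begin
  𝔼 d (λ _ → c)           ≡⟨ 𝔼-cong d ⟩
  𝔼 d (λ _ → c ℚ.* 1ℚ)    ≡⟨ 𝔼-* c d (λ _ → 1ℚ) ⟩
  c ℚ.* 𝔼 d (λ _ → 1ℚ)    ≡⟨ cong (c ℚ.*_) (total L) ⟩
  c ℚ.* 1ℚ                ≡⟨ ℚₚ.*-identityʳ c ⟩
  c                       ∎
  where
  open ≡-Reasoning
  𝔼-cong : ∀ d → 𝔼 d (λ _ → c) ≡ 𝔼 d (λ _ → c ℚ.* 1ℚ)
  𝔼-cong d = cong (λ c → 𝔼 d (λ _ → c)) (sym (ℚₚ.*-identityʳ c))

𝔼-≤ : ∀ {Q : A → Set} {d : Dist A} {f c} → Law Q d → (∀ x → Q x → f x ℚ.≤ c) → 𝔼 d f ℚ.≤ c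
𝔼-≤ {c = c} L f≤c = ℚₚ.≤-trans (𝔼-mono L f≤c) (ℚₚ.≤-reflexive (𝔼-const L c))

Law->>= : ∀ {Q : A → Set} {R : B → Set} {d f} → Law Q d → (∀ x → Q x → Law R (f x)) → Law R (d >>= f)
Law->>= {Q = Q} {R} {d} {f} L K = law
  (Allₚ.concat⁺ (Allₚ.map⁺ (All.map
    (λ {(w , _)} (0≤w , q) → Allₚ.map⁺ (All.map (Product.map₁ λ 0≤v →
       ℚₚ.≤-trans (ℚₚ.≤-reflexive (sym (ℚₚ.*-zeroʳ w))) (*-monoˡ 0≤w 0≤v)) (support (K _ q))))
    (support L))))
  -- The inner masses are known to be 1 only on outcomes satisfying `Q`, so monotonicity is applied
  -- in both directions.
  (trans (𝔼->>= d f _) (ℚₚ.≤-antisym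
    (𝔼-≤ L λ x q → ℚₚ.≤-reflexive (total (K x q)))
    (ℚₚ.≤-trans (ℚₚ.≤-reflexive (sym (total L))) (𝔼-mono L λ x q → ℚₚ.≤-reflexive (sym (total (K x q)))))))

-- The attachment step

-- The random end of the new edge alone; `attach g` is its image under `extend g`, which turns
-- expectations over graphs into degree-weighted sums over vertices.
target : Multigraph t → Dist (Fin (suc t))
target {t} g =
  (+ 1 ℚ./ suc (2 ℕ.* t) , fromℕ t) ∷
  map (λ s → (+ deg g s ℚ./ suc (2 ℕ.* t) , inject₁ s)) (allFin t)

attach≡ : (g : Multigraph t) → attach g ≡ mapDist (extend g) (target g)
attach≡ {t} g = cong ((+ 1 ℚ./ suc (2 ℕ.* t) , extend g (fromℕ t)) ∷_) (Listₚ.map-∘ (allFin _))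

𝔼-attach : (g : Multigraph t) (f : Multigraph (suc t) → ℚ) → 𝔼 (attach g) f ≡ 𝔼 (target g) (f ∘ extend g)
𝔼-attach g f = trans (cong (λ d → 𝔼 d f) (attach≡ g)) (𝔼-mapDist (extend g) (target g) f)

/-+-same : ∀ a b N → (+ a ℚ./ suc N) ℚ.+ (+ b ℚ./ suc N) ≡ + (a ℕ.+ b) ℚ./ suc N
/-+-same a b N = trans (/-+ a N b N)
  (/-≡ {a ℕ.* suc N ℕ.+ b ℕ.* suc N} {suc N ℕ.* suc N} {a ℕ.+ b} {suc N} (distrib a b (suc N)))
  where
  distrib : ∀ a b n → (a ℕ.* n ℕ.+ b ℕ.* n) ℕ.* n ≡ (a ℕ.+ b) ℕ.* (n ℕ.* n)
  distrib = solve-∀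

/-*-whole : ∀ a b N → (+ a ℚ./ suc N) ℚ.* (+ b ℚ./ 1) ≡ + (a ℕ.* b) ℚ./ suc N
/-*-whole a b N = trans (/-* a N b 0) (cong (λ d → + (a ℕ.* b) ℚ./ suc d) (ℕₚ.*-identityʳ N))

𝔼-counts : ∀ N (c : B → ℕ) (h : B → A) (φ : A → ℕ) (xs : List B) →
  𝔼 (map (λ x → (+ c x ℚ./ suc N , h x)) xs) (λ y → + φ y ℚ./ 1)
    ≡ + sum (map (λ x → c x ℕ.* φ (h x)) xs) ℚ./ suc N
𝔼-counts N c h φ [] = /-≡ {0} {1} {0} {suc N} refl
𝔼-counts N c h φ (x ∷ xs) = trans
  (cong₂ ℚ._+_ (/-*-whole (c x) (φ (h x)) N) (𝔼-counts N c h φ xs))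
  (/-+-same (c x ℕ.* φ (h x)) (sum (map (λ x → c x ℕ.* φ (h x)) xs)) N)

sum-allFin : ∀ n (f : Fin n → ℕ) → sum (map f (allFin n)) ≡ ∑ f
sum-allFin n f = trans (cong sum (Listₚ.map-tabulate id f)) (go n f)
  where
  go : ∀ n (f : Fin n → ℕ) → sum (tabulate f) ≡ ∑ f
  go zero    f = refl
  go (suc n) f = cong (f zero ℕ.+_) (go n (f ∘ suc))

∑-select : (φ : Fin n → ℕ) (x : Fin n) → ∑ (λ s → 𝟙 (x Finₚ.≟ s) ℕ.* φ s) ≡ φ x
∑-select {suc n} φ zero = trans
  (cong₂ ℕ._+_ (ℕₚ.*-identityˡ (φ zero)) (∑-const-0 n)) (ℕₚ.+-identityʳ (φ zero))
∑-select {suc n} φ (suc x) = ∑-select (φ ∘ suc) x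

-- Weighted handshake lemma: each edge contributes `φ` once for each of its ends, and a loop twice,
-- in accordance with `deg`.
handshake : (g : Multigraph n) (φ : Fin n → ℕ) →
  ∑ (λ s → deg g s ℕ.* φ s) ≡ sum (map (λ (x , y) → φ x ℕ.+ φ y) g)
handshake {n} [] φ = ∑-const-0 n
handshake ((x , y) ∷ g) φ = begin
  ∑ (λ s → deg ((x , y) ∷ g) s ℕ.* φ s)
    ≡⟨ sum-cong-≗ (λ s → distrib (𝟙 (x Finₚ.≟ s)) (𝟙 (y Finₚ.≟ s)) (deg g s) (φ s)) ⟩
  ∑ (λ s → 𝟙 (x Finₚ.≟ s) ℕ.* φ s ℕ.+ 𝟙 (y Finₚ.≟ s) ℕ.* φ s ℕ.+ deg g s ℕ.* φ s)
    ≡⟨ ∑-distrib-+ (λ s → 𝟙 (x Finₚ.≟ s) ℕ.* φ s ℕ.+ 𝟙 (y Finₚ.≟ s) ℕ.* φ s) (λ s → deg g s ℕ.* φ s) ⟩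
  ∑ (λ s → 𝟙 (x Finₚ.≟ s) ℕ.* φ s ℕ.+ 𝟙 (y Finₚ.≟ s) ℕ.* φ s) ℕ.+ ∑ (λ s → deg g s ℕ.* φ s)
    ≡⟨ cong₂ ℕ._+_ (∑-distrib-+ (λ s → 𝟙 (x Finₚ.≟ s) ℕ.* φ s) (λ s → 𝟙 (y Finₚ.≟ s) ℕ.* φ s)) (handshake g φ) ⟩
  ∑ (λ s → 𝟙 (x Finₚ.≟ s) ℕ.* φ s) ℕ.+ ∑ (λ s → 𝟙 (y Finₚ.≟ s) ℕ.* φ s) ℕ.+ sum (map (λ (x , y) → φ x ℕ.+ φ y) g)
    ≡⟨ cong (ℕ._+ sum (map (λ (x , y) → φ x ℕ.+ φ y) g)) (cong₂ ℕ._+_ (∑-select φ x) (∑-select φ y)) ⟩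
  φ x ℕ.+ φ y ℕ.+ sum (map (λ (x , y) → φ x ℕ.+ φ y) g) ∎
  where
  open ≡-Reasoning
  distrib : ∀ a b c d → (a ℕ.+ b ℕ.+ c) ℕ.* d ≡ a ℕ.* d ℕ.+ b ℕ.* d ℕ.+ c ℕ.* d
  distrib = solve-∀

-- By handshake, the sum of deg g x over the vertices x with a ≤ x.
degFrom : ℕ → Multigraph n → ℕ
degFrom a g = sum (map (λ (x , y) → 𝟙 (a ℕ.≤? toℕ x) ℕ.+ 𝟙 (a ℕ.≤? toℕ y)) g)

∑-deg : (g : Multigraph n) → ∑ (deg g) ≡ 2 ℕ.* length g
∑-deg g = trans (trans (sum-cong-≗ (λ s → sym (ℕₚ.*-identityʳ (deg g s)))) (handshake g (λ _ → 1))) (go g)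
  where
  go : (g : Multigraph n) → sum (map (λ _ → 2) g) ≡ 2 ℕ.* length g
  go []      = refl
  go (_ ∷ g) = trans (cong (2 ℕ.+_) (go g)) (sym (ℕₚ.*-suc 2 (length g)))

-- All weights share the denominator `suc (2 * t)`. With a natural-valued `φ` the expectation is a
-- single fraction, and bounding it becomes an inequality between naturals.
𝔼-target : (g : Multigraph t) (φ : Fin (suc t) → ℕ) →
  𝔼 (target g) (λ s → + φ s ℚ./ 1) ≡ + (φ (fromℕ t) ℕ.+ ∑ (λ s → deg g s ℕ.* φ (inject₁ s))) ℚ./ suc (2 ℕ.* t)
𝔼-target {t} g φ = begin
  (+ 1 ℚ./ N) ℚ.* (+ φ (fromℕ t) ℚ./ 1) ℚ.+ 𝔼 (map (λ s → (+ deg g s ℚ./ N , inject₁ s)) (allFin t)) (λ s → + φ s ℚ./ 1)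
    ≡⟨ cong₂ ℚ._+_ (/-*-whole 1 (φ (fromℕ t)) (2 ℕ.* t)) (𝔼-counts (2 ℕ.* t) (deg g) inject₁ φ (allFin t)) ⟩
  (+ (1 ℕ.* φ (fromℕ t)) ℚ./ N) ℚ.+ (+ sum (map (λ s → deg g s ℕ.* φ (inject₁ s)) (allFin t)) ℚ./ N)
    ≡⟨ /-+-same (1 ℕ.* φ (fromℕ t)) _ (2 ℕ.* t) ⟩
  + (1 ℕ.* φ (fromℕ t) ℕ.+ sum (map (λ s → deg g s ℕ.* φ (inject₁ s)) (allFin t))) ℚ./ N
    ≡⟨ cong (λ i → + i ℚ./ N) (cong₂ ℕ._+_ (ℕₚ.*-identityˡ (φ (fromℕ t))) (sum-allFin t (λ s → deg g s ℕ.* φ (inject₁ s)))) ⟩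
  + (φ (fromℕ t) ℕ.+ ∑ (λ s → deg g s ℕ.* φ (inject₁ s))) ℚ./ N ∎
  where
  open ≡-Reasoning
  N = suc (2 ℕ.* t)

𝟙-yes : {P : Set p} (P? : Dec P) → P → 𝟙 P? ≡ 1
𝟙-yes (yes _) _  = refl
𝟙-yes (no ¬p) px = contradiction px ¬p

𝟙-no : {P : Set p} (P? : Dec P) → ¬ P → 𝟙 P? ≡ 0
𝟙-no (yes px) ¬p = contradiction px ¬p
𝟙-no (no _)   _  = refl

degFrom-≥ : ∀ {a} (g : Multigraph n) → n ℕ.≤ a → degFrom a g ≡ 0
degFrom-≥ [] _ = refl
degFrom-≥ {a = a} ((x , y) ∷ g) n≤a = cong₂ ℕ._+_ (cong₂ ℕ._+_ (absent x) (absent y)) (degFrom-≥ g n≤a)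
  where
  absent : ∀ x → 𝟙 (a ℕ.≤? toℕ x) ≡ 0
  absent x = 𝟙-no (a ℕ.≤? toℕ x) (ℕₚ.<⇒≱ (ℕₚ.<-≤-trans (Finₚ.toℕ<n x) n≤a))

𝟙≤1 : {P : Set p} (P? : Dec P) → 𝟙 P? ℕ.≤ 1
𝟙≤1 (yes _) = ℕₚ.≤-refl
𝟙≤1 (no _)  = ℕ.z≤n

degFrom-inject₁ : ∀ a (g : Multigraph n) → degFrom a (relabel inject₁ g) ≡ degFrom a g
degFrom-inject₁ a [] = refl
degFrom-inject₁ a ((x , y) ∷ g) = cong₂ ℕ._+_
  (cong₂ ℕ._+_ (cong (λ i → 𝟙 (a ℕ.≤? i)) (Finₚ.toℕ-inject₁ x)) (cong (λ i → 𝟙 (a ℕ.≤? i)) (Finₚ.toℕ-inject₁ y)))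
  (degFrom-inject₁ a g)

-- The invariant of the process. The last `k` vertices meet only the `k` edges that they brought
-- along, which have `2 k` ends; writing `t` as `k + a` avoids subtraction.
Grown : (t : ℕ) → Multigraph t → Set
Grown t g = length g ≡ t × (∀ k a → t ≡ k ℕ.+ a → degFrom a g ℕ.≤ k ℕ.+ k)

Grown-extend : (g : Multigraph t) (s : Fin (suc t)) → Grown t g → Grown (suc t) (extend g s)
Grown-extend {t} g s (len , grown) = cong suc (trans (Listₚ.length-map _ g) len) , grown′
  where
  grown′ : ∀ k a → suc t ≡ k ℕ.+ a → degFrom a (extend g s) ℕ.≤ k ℕ.+ k
  grown′ zero a refl = ℕₚ.≤-reflexive (degFrom-≥ (extend g s) ℕₚ.≤-refl)
  grown′ (suc k) a eq = ℕₚ.≤-trans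
    (ℕₚ.+-mono-≤ (ℕₚ.+-mono-≤ (𝟙≤1 (a ℕ.≤? toℕ (fromℕ t))) (𝟙≤1 (a ℕ.≤? toℕ s)))
      (ℕₚ.≤-trans (ℕₚ.≤-reflexive (degFrom-inject₁ a g)) (grown k a (ℕₚ.suc-injective eq))))
    (ℕₚ.≤-reflexive (cong suc (sym (ℕₚ.+-suc k k))))

-- A graph with `t` edges has total degree `2 t`; together with the weight 1 of the new loop this
-- matches the denominator.
Law-target : (g : Multigraph t) → Grown t g → Law (λ _ → ⊤) (target g)
Law-target {t} g (len , _) = law
  ((0≤/ 1 (suc (2 ℕ.* t)) , tt) ∷ Allₚ.map⁺ (All.universal (λ s → 0≤/ (deg g s) (suc (2 ℕ.* t)) , tt) (allFin t)))
  (begin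
    𝔼 (target g) (λ _ → 1ℚ)                                  ≡⟨ 𝔼-target g (λ _ → 1) ⟩
    + suc (∑ (λ s → deg g s ℕ.* 1)) ℚ./ suc (2 ℕ.* t)        ≡⟨ cong (λ i → + suc i ℚ./ suc (2 ℕ.* t)) deg≡ ⟩
    + suc (2 ℕ.* t) ℚ./ suc (2 ℕ.* t)                        ≡⟨ /-≡ {suc (2 ℕ.* t)} {suc (2 ℕ.* t)} {1} {1} (ℕₚ.*-comm (suc (2 ℕ.* t)) 1) ⟩
    1ℚ                                                       ∎)
  where
  open ≡-Reasoning
  deg≡ : ∑ (λ s → deg g s ℕ.* 1) ≡ 2 ℕ.* t
  deg≡ = trans (sum-cong-≗ (λ s → ℕₚ.*-identityʳ (deg g s))) (trans (∑-deg g) (cong (2 ℕ.*_) len))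

Law-mapDist : ∀ {Q : A → Set} {R : B → Set} {d} (f : A → B) → Law Q d → (∀ x → Q x → R (f x)) → Law R (mapDist f d)
Law-mapDist {d = d} f L Q⇒R = law (Allₚ.map⁺ (All.map (Product.map₂ (Q⇒R _)) (support L)))
  (trans (𝔼-mapDist f d (λ _ → 1ℚ)) (total L))

Law-attach : (g : Multigraph t) → Grown t g → Law (Grown (suc t)) (attach g)
Law-attach g grown = subst (Law _) (sym (attach≡ g))
  (Law-mapDist (extend g) (Law-target g grown) (λ s _ → Grown-extend g s grown))

Law-G₁ : ∀ t → Law (Grown t) (G₁ t)
Law-G₁ zero    = law ((0≤/ 1 1 , refl , λ _ _ _ → ℕ.z≤n) ∷ []) refl
Law-G₁ (suc t) = Law->>= (Law-G₁ t) Law-attach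

-- Edges leaving a block

-- For the block of vertices from `a` up to but excluding `b`. Since `extend` puts the arriving
-- vertex first in its pair, only this orientation has to be tested.
Exit : ℕ → ℕ → Multigraph t → Set
Exit a b = Any (λ (x , y) → (a ℕ.≤ toℕ x × toℕ x ℕ.< b) × toℕ y ℕ.< a)

exit? : ∀ a b → Decidable (Exit {t} a b)
exit? a b = Any.any? λ (x , y) → ((a ℕ.≤? toℕ x) ×-dec (toℕ x ℕ.<? b)) ×-dec (toℕ y ℕ.<? a)

Exit-extend : ∀ {a b} (g : Multigraph t) s → Exit a b g → Exit a b (extend g s)
Exit-extend {a = a} {b} g s exit = there (Anyₚ.map⁺ (Any.map
  (λ {(x , y)} → subst₂ (λ i j → (a ℕ.≤ i × i ℕ.< b) × j ℕ.< a) (sym (Finₚ.toℕ-inject₁ x)) (sym (Finₚ.toℕ-inject₁ y))) exit))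

miss : {P : A → Set} → Decidable P → A → ℚ
miss P? x = indicator (¬? (P? x))

miss-no : {P : A → Set} (P? : Decidable P) → ∀ {x} → P x → miss P? x ≡ 0ℚ
miss-no P? {x} px with P? x
... | yes _  = refl
... | no ¬px = contradiction px ¬px

-- A property that survives every extension cannot be lost, so one more step never raises the
-- probability of its failure.
𝔼-attach-miss : ∀ {P : Multigraph t → Set} {P′ : Multigraph (suc t) → Set}
  (P? : Decidable P) (P′? : Decidable P′) → (∀ g s → P g → P′ (extend g s)) →
  ∀ g → Grown t g → 𝔼 (attach g) (miss P′?) ℚ.≤ miss P? g
𝔼-attach-miss P? P′? mono g grown =
  ℚₚ.≤-trans (ℚₚ.≤-reflexive (𝔼-attach g _)) (𝔼-≤ (Law-target g grown) λ s _ →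
    indicator-mono (¬? (P′? (extend g s))) (¬? (P? g)) (λ ¬p′ px → ¬p′ (mono g s px)))

𝔼-G₁-miss : ∀ {P : Multigraph t → Set} {P′ : Multigraph (suc t) → Set}
  (P? : Decidable P) (P′? : Decidable P′) → (∀ g s → P g → P′ (extend g s)) →
  𝔼 (G₁ (suc t)) (miss P′?) ℚ.≤ 𝔼 (G₁ t) (miss P?)
𝔼-G₁-miss {t} P? P′? mono =
  ℚₚ.≤-trans (ℚₚ.≤-reflexive (𝔼->>= (G₁ t) attach _)) (𝔼-mono (Law-G₁ t) (𝔼-attach-miss P? P′? mono))

-- The k vertices from a on have total degree at most 2 k; the new vertex adds 1.
rate : ℕ → ℕ → ℚ
rate a k = + suc (k ℕ.+ k) ℚ./ suc (2 ℕ.* (k ℕ.+ a))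

-- Without an exit so far, the next edge is no exit iff its target is at least a.
𝔼-attach-exit : ∀ a {b} k → k ℕ.+ a ℕ.< b → ∀ g → Grown (k ℕ.+ a) g →
  𝔼 (attach g) (miss (exit? a b)) ℚ.≤ rate a k ℚ.* miss (exit? a b) g
𝔼-attach-exit a {b} k k+a<b g grown with exit? a b g
-- The right side is 0 here, and so is the bound on the left, because exits persist.
... | yes exit = ℚₚ.≤-trans
  (subst (𝔼 (attach g) (miss (exit? a b)) ℚ.≤_) (miss-no (exit? a b) exit)
    (𝔼-attach-miss (exit? a b) (exit? a b) Exit-extend g grown))
  (ℚₚ.≤-reflexive (sym (ℚₚ.*-zeroʳ (rate a k))))
... | no _ = begin
  𝔼 (attach g) (miss (exit? a b))               ≡⟨ 𝔼-attach g (miss (exit? a b)) ⟩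
  𝔼 (target g) (miss (exit? a b) ∘ extend g)    ≤⟨ 𝔼-mono (Law-target g grown) (λ s _ → bound s) ⟩
  𝔼 (target g) (λ s → + φ s ℚ./ 1)              ≡⟨ 𝔼-target g φ ⟩
  + (φ (fromℕ (k ℕ.+ a)) ℕ.+ ∑ (λ s → deg g s ℕ.* φ (inject₁ s))) ℚ./ N
    ≤⟨ /-mono-≤ {φ (fromℕ (k ℕ.+ a)) ℕ.+ ∑ (λ s → deg g s ℕ.* φ (inject₁ s))} {N} {suc (k ℕ.+ k)} {N}
         (ℕₚ.*-monoˡ-≤ N (ℕₚ.+-mono-≤ (𝟙≤1 (a ℕ.≤? toℕ (fromℕ (k ℕ.+ a)))) deg≤)) ⟩
  rate a k                                      ≡⟨ ℚₚ.*-identityʳ (rate a k) ⟨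
  rate a k ℚ.* 1ℚ                               ∎
  where
  open ℚₚ.≤-Reasoning
  N = suc (2 ℕ.* (k ℕ.+ a))
  φ : ∀ {n} → Fin n → ℕ
  φ s = 𝟙 (a ℕ.≤? toℕ s)
  deg≤ : ∑ (λ s → deg g s ℕ.* φ (inject₁ s)) ℕ.≤ k ℕ.+ k
  deg≤ = ℕₚ.≤-trans (ℕₚ.≤-reflexive (trans
    (sum-cong-≗ (λ s → cong (λ i → deg g s ℕ.* 𝟙 (a ℕ.≤? i)) (Finₚ.toℕ-inject₁ s))) (handshake g φ)))
    (proj₂ grown k a refl)
  bound : ∀ s → miss (exit? a b) (extend g s) ℚ.≤ + φ s ℚ./ 1
  bound s = case a ℕ.≤? toℕ s of λ where
    (yes a≤s) → subst (λ i → miss (exit? a b) (extend g s) ℚ.≤ + i ℚ./ 1) (sym (𝟙-yes (a ℕ.≤? toℕ s) a≤s))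
      (indicator≤1 (¬? (exit? a b (extend g s))))
    -- A target below `a` makes the new edge an exit, as its other end `k + a` lies between `a` and
    -- `b`.
    (no a≰s) → subst₂ (λ x i → x ℚ.≤ + i ℚ./ 1)
      (sym (miss-no (exit? a b) {extend g s} (here
        ((subst (a ℕ.≤_) (sym (Finₚ.toℕ-fromℕ (k ℕ.+ a))) (ℕₚ.m≤n+m a k) ,
          subst (ℕ._< b) (sym (Finₚ.toℕ-fromℕ (k ℕ.+ a))) k+a<b) , ℕₚ.≰⇒> a≰s))))
      (sym (𝟙-no (a ℕ.≤? toℕ s) a≰s)) ℚₚ.≤-refl

-- Only the edges brought by vertices `a` and `suc a` are exploited. Conditioning each on the graph
-- before it gives the product of two rates, and later edges cannot undo an exit.
𝔼-miss-exit : ∀ a {b} k → suc a ℕ.< b →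
  𝔼 (G₁ (suc (suc k) ℕ.+ a)) (miss (exit? a b)) ℚ.≤ rate a 1 ℚ.* rate a 0
𝔼-miss-exit a {b} (suc k) a<b =
  ℚₚ.≤-trans (𝔼-G₁-miss {suc (suc k) ℕ.+ a} (exit? a b) (exit? a b) Exit-extend) (𝔼-miss-exit a k a<b)
𝔼-miss-exit a {b} zero a<b = begin
  𝔼 (G₁ (2 ℕ.+ a)) f                          ≡⟨ 𝔼->>= (G₁ (1 ℕ.+ a)) attach f ⟩
  𝔼 (G₁ (1 ℕ.+ a)) (λ g → 𝔼 (attach g) f)     ≤⟨ 𝔼-mono (Law-G₁ (1 ℕ.+ a)) (𝔼-attach-exit a 1 a<b) ⟩
  𝔼 (G₁ (1 ℕ.+ a)) (λ g → rate a 1 ℚ.* f g)   ≡⟨ 𝔼-* (rate a 1) (G₁ (1 ℕ.+ a)) f ⟩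
  rate a 1 ℚ.* 𝔼 (G₁ (1 ℕ.+ a)) f             ≤⟨ *-monoˡ (0≤rate 1) first ⟩
  rate a 1 ℚ.* rate a 0                       ∎
  where
  open ℚₚ.≤-Reasoning
  f : Multigraph n → ℚ
  f = miss (exit? a b)
  0≤rate : ∀ k → 0ℚ ℚ.≤ rate a k
  0≤rate k = 0≤/ (suc (k ℕ.+ k)) (suc (2 ℕ.* (k ℕ.+ a)))
  first : 𝔼 (G₁ (1 ℕ.+ a)) f ℚ.≤ rate a 0
  -- Before vertex `a` arrives the failure indicator is bounded by 1, which leaves the rate alone.
  first = ℚₚ.≤-trans (ℚₚ.≤-reflexive (𝔼->>= (G₁ a) attach f)) (𝔼-≤ (Law-G₁ a) λ g grown →
    ℚₚ.≤-trans (𝔼-attach-exit a 0 (ℕₚ.<-trans ℕₚ.≤-refl a<b) g grown)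
      (ℚₚ.≤-trans (*-monoˡ (0≤rate 0) (indicator≤1 (¬? (exit? a b g)))) (ℚₚ.≤-reflexive (ℚₚ.*-identityʳ (rate a 0)))))

-- Blocks

union-bound : {P Q R : Set} (P? : Dec P) (Q? : Dec Q) (R? : Dec R) → (P → Q → R) →
  indicator (¬? R?) ℚ.≤ indicator (¬? P?) ℚ.+ indicator (¬? Q?)
union-bound (yes p) Q?      R? PQ⇒R = ℚₚ.≤-trans (indicator-mono (¬? R?) (¬? Q?) (λ ¬r q → ¬r (PQ⇒R p q)))
  (ℚₚ.≤-reflexive (sym (ℚₚ.+-identityˡ (indicator (¬? Q?)))))
union-bound (no _)  Q?      R? PQ⇒R = ℚₚ.≤-trans (indicator≤1 (¬? R?))
  (ℚₚ.≤-trans (ℚₚ.≤-reflexive (sym (ℚₚ.+-identityʳ 1ℚ))) (ℚₚ.+-monoʳ-≤ 1ℚ (0≤indicator (¬? Q?))))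

module _ (m w : ℕ) where

  -- The condition on the first `j` blocks, with those below `w` exempt. It makes sense for a graph
  -- of any size and lets one block be split off at a time.
  AllExit : ℕ → Multigraph t → Set
  AllExit zero    g = ⊤
  AllExit (suc j) g = (w ℕ.≤ j → Exit (j ℕ.* m) (suc j ℕ.* m) g) × AllExit j g

  allExit? : ∀ j → Decidable (AllExit {t} j)
  allExit? zero    g = yes tt
  allExit? (suc j) g = ((w ℕ.≤? j) →-dec exit? (j ℕ.* m) (suc j ℕ.* m) g) ×-dec allExit? j g

  AllExit-extend : ∀ j (g : Multigraph t) s → AllExit j g → AllExit j (extend g s)
  AllExit-extend zero    g s _             = tt
  AllExit-extend (suc j) g s (exit , good) = Exit-extend g s ∘ exit , AllExit-extend j g s good

  AllExit-≤w : ∀ j → j ℕ.≤ w → (g : Multigraph t) → AllExit j g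
  AllExit-≤w zero    _   g = tt
  AllExit-≤w (suc j) j<w g = (λ w≤j → contradiction w≤j (ℕₚ.<⇒≱ j<w)) , AllExit-≤w j (ℕₚ.<⇒≤ j<w) g

  AllExit⇒Exit : ∀ {i} j (g : Multigraph t) → w ℕ.≤ i → i ℕ.< j → AllExit j g → Exit (i ℕ.* m) (suc i ℕ.* m) g
  AllExit⇒Exit (suc j) g w≤i i<1+j (exit , good) with ℕₚ.m≤n⇒m<n∨m≡n (ℕₚ.≤-pred i<1+j)
  ... | inj₁ i<j  = AllExit⇒Exit j g w≤i i<j good
  ... | inj₂ refl = exit w≤i

  𝔼-miss-allExit-extend : ∀ j k → 𝔼 (G₁ (k ℕ.+ t)) (miss (allExit? j)) ℚ.≤ 𝔼 (G₁ t) (miss (allExit? j))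
  𝔼-miss-allExit-extend j zero = ℚₚ.≤-refl
  𝔼-miss-allExit-extend {t} j (suc k) =
    ℚₚ.≤-trans (𝔼-G₁-miss {k ℕ.+ t} (allExit? j) (allExit? j) (AllExit-extend j)) (𝔼-miss-allExit-extend j k)

  miss-allExit-suc : ∀ j (g : Multigraph t) →
    miss (allExit? (suc j)) g ℚ.≤ miss (exit? (j ℕ.* m) (suc j ℕ.* m)) g ℚ.+ miss (allExit? j) g
  miss-allExit-suc j g = union-bound (exit? (j ℕ.* m) (suc j ℕ.* m) g) (allExit? j g) (allExit? (suc j) g)
    (λ exit good → (λ _ → exit) , good)

-- Telescoping the failure probabilities

halfInv : ℕ → ℚ
halfInv k = + 1 ℚ./ (2 ℕ.* suc k)

0≤halfInv : ∀ k → 0ℚ ℚ.≤ halfInv k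
0≤halfInv k = 0≤/ 1 (2 ℕ.* suc k)

-- With `n = suc k`, the product of rates is at most `3 / ((4 n + 1) (4 n + 3))`, which is below
-- `1 / (2 n (n + 1))`, the difference of the two values of `halfInv`.
rate-bound : ∀ k a → 2 ℕ.* suc k ℕ.≤ a → rate a 1 ℚ.* rate a 0 ℚ.+ halfInv (suc k) ℚ.≤ halfInv k
rate-bound k a 2n≤a = begin
  rate a 1 ℚ.* rate a 0 ℚ.+ halfInv (suc k)
    ≡⟨ cong (ℚ._+ halfInv (suc k)) (/-* 3 (2 ℕ.* (1 ℕ.+ a)) 1 (2 ℕ.* a)) ⟩
  (+ 3 ℚ./ (D₁ ℕ.* D₀)) ℚ.+ halfInv (suc k)
    ≡⟨ /-+ 3 (ℕ.pred (D₁ ℕ.* D₀)) 1 (ℕ.pred (2 ℕ.* suc (suc k))) ⟩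
  + (3 ℕ.* (2 ℕ.* suc (suc k)) ℕ.+ 1 ℕ.* (D₁ ℕ.* D₀)) ℚ./ (D₁ ℕ.* D₀ ℕ.* (2 ℕ.* suc (suc k)))
    ≤⟨ /-mono-≤ {3 ℕ.* (2 ℕ.* suc (suc k)) ℕ.+ 1 ℕ.* (D₁ ℕ.* D₀)} {D₁ ℕ.* D₀ ℕ.* (2 ℕ.* suc (suc k))} {1} {2 ℕ.* suc k} cross ⟩
  halfInv k ∎
  where
  open ℚₚ.≤-Reasoning
  D₀ = suc (2 ℕ.* a)
  D₁ = suc (2 ℕ.* (1 ℕ.+ a))
  cross : (3 ℕ.* (2 ℕ.* suc (suc k)) ℕ.+ 1 ℕ.* (D₁ ℕ.* D₀)) ℕ.* (2 ℕ.* suc k) ℕ.≤ 1 ℕ.* (D₁ ℕ.* D₀ ℕ.* (2 ℕ.* suc (suc k)))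
  -- Substituting `a = 2 n + o` makes the difference of the two sides a polynomial in `n` and `o`
  -- with nonnegative coefficients.
  cross with ℕₚ.m≤n⇒∃[o]m+o≡n 2n≤a
  ... | o , refl = ℕₚ.≤-trans (ℕₚ.m≤m+n _ _) (ℕₚ.≤-reflexive (identity (suc k) o))
    where
    identity : ∀ n o →
      (3 ℕ.* (2 ℕ.* suc n) ℕ.+ 1 ℕ.* (suc (2 ℕ.* (1 ℕ.+ (2 ℕ.* n ℕ.+ o))) ℕ.* suc (2 ℕ.* (2 ℕ.* n ℕ.+ o)))) ℕ.* (2 ℕ.* n)
      ℕ.+ (20 ℕ.* n ℕ.* n ℕ.+ 20 ℕ.* n ℕ.+ 6 ℕ.+ 16 ℕ.* o ℕ.+ 8 ℕ.* o ℕ.* o ℕ.+ 32 ℕ.* n ℕ.* o)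
      ≡ 1 ℕ.* (suc (2 ℕ.* (1 ℕ.+ (2 ℕ.* n ℕ.+ o))) ℕ.* suc (2 ℕ.* (2 ℕ.* n ℕ.+ o)) ℕ.* (2 ℕ.* suc n))
    identity = solve-∀

module _ {m} (2≤m : 2 ℕ.≤ m) (v : ℕ) where

  private
    w = suc v

  𝔼-miss-allExit-zero : ∀ n → n ℕ.≤ w → 𝔼 (G₁ (n ℕ.* m)) (miss (allExit? m w n)) ℚ.≤ 0ℚ
  𝔼-miss-allExit-zero n n≤w = 𝔼-≤ (Law-G₁ (n ℕ.* m)) λ g _ →
    ℚₚ.≤-reflexive (miss-no (allExit? m w n) (AllExit-≤w m w n n≤w g))

  -- The bound `2 ≤ m` enters twice: block `j` starts at `j * m`, which is at least `2 * j`, and it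
  -- contains the two vertices whose edges are exploited.
  𝔼-miss-exit-block : ∀ k → let j = suc k in
    𝔼 (G₁ (suc j ℕ.* m)) (miss (exit? (j ℕ.* m) (suc j ℕ.* m))) ℚ.+ halfInv j ℚ.≤ halfInv k
  𝔼-miss-exit-block k = ℚₚ.≤-trans (ℚₚ.+-monoˡ-≤ (halfInv j) bound)
    (rate-bound k (j ℕ.* m) (ℕₚ.≤-trans (ℕₚ.≤-reflexive (ℕₚ.*-comm 2 j)) (ℕₚ.*-monoʳ-≤ j 2≤m)))
    where
    j = suc k
    bound : 𝔼 (G₁ (suc j ℕ.* m)) (miss (exit? (j ℕ.* m) (suc j ℕ.* m)))
            ℚ.≤ rate (j ℕ.* m) 1 ℚ.* rate (j ℕ.* m) 0
    bound with ℕₚ.m≤n⇒∃[o]m+o≡n 2≤m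
    ... | o , refl = 𝔼-miss-exit (j ℕ.* m) o (ℕₚ.+-monoˡ-≤ (j ℕ.* m) 2≤m)

  𝔼-miss-allExit : ∀ i → 𝔼 (G₁ ((i ℕ.+ w) ℕ.* m)) (miss (allExit? m w (i ℕ.+ w))) ℚ.+ halfInv (i ℕ.+ v) ℚ.≤ halfInv v
  𝔼-miss-allExit zero = ℚₚ.≤-trans (ℚₚ.+-monoˡ-≤ (halfInv v) (𝔼-miss-allExit-zero w ℕₚ.≤-refl))
    (ℚₚ.≤-reflexive (ℚₚ.+-identityˡ (halfInv v)))
  𝔼-miss-allExit (suc i) = begin
    𝔼 (G₁ (suc j ℕ.* m)) (miss (allExit? m w (suc j))) ℚ.+ halfInv (suc l)
      ≤⟨ ℚₚ.+-monoˡ-≤ (halfInv (suc l)) (𝔼-mono (Law-G₁ (suc j ℕ.* m)) λ g _ → miss-allExit-suc m w j g) ⟩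
    𝔼 (G₁ (suc j ℕ.* m)) (λ g → exits g ℚ.+ miss (allExit? m w j) g) ℚ.+ halfInv (suc l)
      ≡⟨ cong (ℚ._+ halfInv (suc l)) (𝔼-+ (G₁ (suc j ℕ.* m)) exits (miss (allExit? m w j))) ⟩
    P ℚ.+ Q ℚ.+ halfInv (suc l)
      ≡⟨ xy∙z≈xz∙y P Q (halfInv (suc l)) ⟩
    P ℚ.+ halfInv (suc l) ℚ.+ Q
      -- The new block's failure is absorbed into the remainder, while failure among the earlier
      -- blocks is bounded by its probability `m` steps before.
      ≤⟨ ℚₚ.+-mono-≤ exit-block (𝔼-miss-allExit-extend m w j m) ⟩
    halfInv l ℚ.+ 𝔼 (G₁ (j ℕ.* m)) (miss (allExit? m w j))
      ≡⟨ ℚₚ.+-comm (halfInv l) _ ⟩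
    𝔼 (G₁ (j ℕ.* m)) (miss (allExit? m w j)) ℚ.+ halfInv l
      ≤⟨ 𝔼-miss-allExit i ⟩
    halfInv v ∎
    where
    open ℚₚ.≤-Reasoning
    j = i ℕ.+ w
    l = i ℕ.+ v
    exits : Multigraph (suc j ℕ.* m) → ℚ
    exits = miss (exit? (j ℕ.* m) (suc j ℕ.* m))
    P = 𝔼 (G₁ (suc j ℕ.* m)) exits
    Q = 𝔼 (G₁ (suc j ℕ.* m)) (miss (allExit? m w j))
    exit-block : P ℚ.+ halfInv (suc l) ℚ.≤ halfInv l
    exit-block = subst
      (λ j → 𝔼 (G₁ (suc j ℕ.* m)) (miss (exit? (j ℕ.* m) (suc j ℕ.* m))) ℚ.+ halfInv (suc l) ℚ.≤ halfInv l)
      (sym (ℕₚ.+-suc i v)) (𝔼-miss-exit-block l)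

  𝔼-miss-allExit-≤ : ∀ n → 𝔼 (G₁ (n ℕ.* m)) (miss (allExit? m w n)) ℚ.≤ halfInv v
  𝔼-miss-allExit-≤ n with ℕₚ.≤-total n w
  ... | inj₁ n≤w = ℚₚ.≤-trans (𝔼-miss-allExit-zero n n≤w) (0≤halfInv v)
  ... | inj₂ w≤n = subst (λ n → 𝔼 (G₁ (n ℕ.* m)) (miss (allExit? m w n)) ℚ.≤ halfInv v) (ℕₚ.m∸n+n≡m w≤n)
    (ℚₚ.≤-trans (ℚₚ.≤-trans (ℚₚ.≤-reflexive (sym (ℚₚ.+-identityʳ _)))
                  (ℚₚ.+-monoʳ-≤ (𝔼 (G₁ (j ℕ.* m)) (miss (allExit? m w j))) (0≤halfInv (n ℕ.∸ w ℕ.+ v))))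
                (𝔼-miss-allExit (n ℕ.∸ w)))
    where j = n ℕ.∸ w ℕ.+ w

  -- Merging blocks into vertices

  toℕ-quotient : ∀ {n} (x : Fin (n ℕ.* m)) → ∃[ r ] (r ℕ.< m × toℕ x ≡ toℕ (quotient {n} m x) ℕ.* m ℕ.+ r)
  toℕ-quotient {n} x = toℕ r , Finₚ.toℕ<n r , (begin
    toℕ x                  ≡⟨ cong toℕ (Finₚ.combine-remQuot {n} m x) ⟨
    toℕ (Fin.combine q r)  ≡⟨ Finₚ.toℕ-combine q r ⟩
    m ℕ.* toℕ q ℕ.+ toℕ r  ≡⟨ cong (ℕ._+ toℕ r) (ℕₚ.*-comm m (toℕ q)) ⟩
    toℕ q ℕ.* m ℕ.+ toℕ r  ∎)
    where
    open ≡-Reasoning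
    q = quotient {n} m x
    r = proj₂ (Fin.remQuot {n} m x)

  quotient*≤ : ∀ {n} (x : Fin (n ℕ.* m)) → toℕ (quotient {n} m x) ℕ.* m ℕ.≤ toℕ x
  quotient*≤ {n} x with toℕ-quotient {n} x
  ... | r , _ , eq = ℕₚ.≤-trans (ℕₚ.m≤m+n _ r) (ℕₚ.≤-reflexive (sym eq))

  <suc-quotient* : ∀ {n} (x : Fin (n ℕ.* m)) → toℕ x ℕ.< suc (toℕ (quotient {n} m x)) ℕ.* m
  <suc-quotient* {n} x with toℕ-quotient {n} x
  ... | r , r<m , eq = ℕₚ.≤-trans (ℕₚ.≤-reflexive (cong suc (trans eq (ℕₚ.+-comm _ r)))) (ℕₚ.+-monoˡ-≤ _ r<m)

  quotient-< : ∀ {n} (y : Fin (n ℕ.* m)) {i} → toℕ y ℕ.< i ℕ.* m → toℕ (quotient {n} m y) ℕ.< i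
  quotient-< {n} y {i} y<im = ℕₚ.*-cancelʳ-< m _ i (ℕₚ.≤-<-trans (quotient*≤ {n} y) y<im)

  quotient-≡ : ∀ {n} (x : Fin (n ℕ.* m)) (j : Fin n) → toℕ j ℕ.* m ℕ.≤ toℕ x → toℕ x ℕ.< suc (toℕ j) ℕ.* m →
               quotient {n} m x ≡ j
  quotient-≡ {n} x j lb ub = Finₚ.toℕ-injective (ℕₚ.≤-antisym
    (ℕₚ.≤-pred (quotient-< {n} x ub))
    (ℕₚ.≤-pred (ℕₚ.*-cancelʳ-< m (toℕ j) _ (ℕₚ.≤-<-trans lb (<suc-quotient* {n} x)))))

  -- After merging, an exit of block `j` is an edge from `j` to a smaller vertex, which is what the
  -- forest takes as parent edge.
  AllExit⇒n≤w*𝒯 : ∀ {n} (g : Multigraph (n ℕ.* m)) → AllExit m w n g → n ℕ.≤ w ℕ.* 𝒯 (relabel (quotient {n} m) g)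
  AllExit⇒n≤w*𝒯 {n} g good = n≤w*𝒯 (relabel (quotient {n} m) g) w λ j w≤j →
    fromAny (Anyₚ.map⁺ (Any.map (λ {(x , y)} ((lb , ub) , y<) → merge j x y lb ub y<)
      (AllExit⇒Exit m w n g w≤j (Finₚ.toℕ<n j) good)))
    where
    merge : ∀ (j : Fin n) x y → toℕ j ℕ.* m ℕ.≤ toℕ x → toℕ x ℕ.< suc (toℕ j) ℕ.* m → toℕ y ℕ.< toℕ j ℕ.* m →
            ∃[ u ] ((quotient {n} m x , quotient {n} m y) ≡ (j , u) × u Fin.< j)
    merge j x y lb ub y< = quotient m y , cong (_, quotient m y) (quotient-≡ x j lb ub) , quotient-< {n} y y<
    fromAny : ∀ {j : Fin n} {h : Multigraph n} → Any (λ e → ∃[ u ] (e ≡ (j , u) × u Fin.< j)) h →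
              ∃[ e ] ∃[ u ] (lookup h e ≡ (j , u) × u Fin.< j)
    fromAny a = Any.index a , Anyₚ.lookup-index a

  -- Every graph either satisfies `P` or has a block from `w` on without exit, so the two indicators
  -- add up to at least 1; taking expectations gives the bound.
  Prob-≥ : ∀ n {P : Multigraph n → Set} (P? : Decidable P) → (∀ g → n ℕ.≤ w ℕ.* 𝒯 g → P g) →
           1ℚ ℚ.- halfInv v ℚ.≤ Prob (G m n) P?
  Prob-≥ n P? n≤⇒P = begin
    1ℚ ℚ.- halfInv v
      ≤⟨ ℚₚ.+-monoˡ-≤ (ℚ.- halfInv v) (ℚₚ.≤-trans (ℚₚ.≤-reflexive (sym (total (Law-G₁ (n ℕ.* m)))))
          (𝔼-mono (Law-G₁ (n ℕ.* m)) λ g _ → split (P? (f g)) (allExit? m w n g) (n≤⇒P (f g) ∘ AllExit⇒n≤w*𝒯 {n} g))) ⟩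
    𝔼 d (λ g → indicator (P? (f g)) ℚ.+ miss (allExit? m w n) g) ℚ.- halfInv v
      ≡⟨ cong (ℚ._- halfInv v) (𝔼-+ d (indicator ∘ P? ∘ f) (miss (allExit? m w n))) ⟩
    𝔼 d (indicator ∘ P? ∘ f) ℚ.+ 𝔼 d (miss (allExit? m w n)) ℚ.- halfInv v
      ≤⟨ ℚₚ.+-monoˡ-≤ (ℚ.- halfInv v) (ℚₚ.+-monoʳ-≤ (𝔼 d (indicator ∘ P? ∘ f)) (𝔼-miss-allExit-≤ n)) ⟩
    𝔼 d (indicator ∘ P? ∘ f) ℚ.+ halfInv v ℚ.- halfInv v
      ≡⟨ ℚₚ.+-assoc (𝔼 d (indicator ∘ P? ∘ f)) (halfInv v) (ℚ.- halfInv v) ⟩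
    𝔼 d (indicator ∘ P? ∘ f) ℚ.+ (halfInv v ℚ.- halfInv v)
      ≡⟨ cong (𝔼 d (indicator ∘ P? ∘ f) ℚ.+_) (ℚₚ.+-inverseʳ (halfInv v)) ⟩
    𝔼 d (indicator ∘ P? ∘ f) ℚ.+ 0ℚ
      ≡⟨ ℚₚ.+-identityʳ _ ⟩
    𝔼 d (indicator ∘ P? ∘ f)
      ≡⟨ trans (Prob≡𝔼 (G m n) P?) (𝔼-mapDist f d (indicator ∘ P?)) ⟨
    Prob (G m n) P? ∎
    where
    open ℚₚ.≤-Reasoning
    d = G₁ (n ℕ.* m)
    f = relabel (quotient {n} m)
    split : {P Q : Set} (P? : Dec P) (Q? : Dec Q) → (Q → P) → 1ℚ ℚ.≤ indicator P? ℚ.+ indicator (¬? Q?)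
    split P? (no _) _ = ℚₚ.≤-trans (ℚₚ.≤-reflexive (sym (ℚₚ.+-identityˡ 1ℚ))) (ℚₚ.+-monoˡ-≤ 1ℚ (0≤indicator P?))
    split (yes _) (yes _) _ = ℚₚ.≤-refl
    split (no ¬p) (yes q) Q⇒P = contradiction (Q⇒P q) ¬p

Prob-≤1 : ∀ m n {P : Multigraph n → Set} (P? : Decidable P) → Prob (G m n) P? ℚ.≤ 1ℚ
Prob-≤1 m n P? = ℚₚ.≤-trans (ℚₚ.≤-reflexive (trans (Prob≡𝔼 (G m n) P?) (𝔼-mapDist (relabel (quotient m)) (G₁ (n ℕ.* m)) (indicator ∘ P?))))
  (𝔼-≤ (Law-G₁ (n ℕ.* m)) λ g _ → indicator≤1 (P? (relabel (quotient m) g)))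

-- Limits and conclusion

halfInv-small : ∀ δ → 0ℚ ℚ.< δ → ∃[ K ] (∀ k → K ℕ.≤ k → halfInv k ℚ.< δ)
-- Here `δ` is `(a + 1) / (d + 1)`, so `d` serves as threshold: `2 (k + 1)` exceeds `d + 1` as soon
-- as `d ≤ k`.
halfInv-small δ@(ℚ.mkℚ +[1+ a ] d _) _ = d , λ k d≤k → subst (halfInv k ℚ.<_) (ℚₚ.fromℚᵘ-toℚᵘ δ) (lt k d≤k)
  where
  lt : ∀ k → d ℕ.≤ k → halfInv k ℚ.< + suc a ℚ./ suc d
  lt k d≤k = /-mono-< {1} {2 ℕ.* suc k} {suc a} {suc d} (begin-strict
    1 ℕ.* suc d              ≡⟨ ℕₚ.*-identityˡ (suc d) ⟩
    suc d                    ≤⟨ ℕ.s≤s d≤k ⟩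
    suc k                    <⟨ ℕₚ.m<m+n (suc k) ℕₚ.0<1+n ⟩
    2 ℕ.* suc k              ≤⟨ ℕₚ.m≤m+n (2 ℕ.* suc k) _ ⟩
    suc a ℕ.* (2 ℕ.* suc k)  ∎)
    where open ℕₚ.≤-Reasoning
halfInv-small (ℚ.mkℚ (+ 0) d _) (ℚ.*<* (ℤ.+<+ ()))
halfInv-small (ℚ.mkℚ ℤ.-[1+ a ] d _) (ℚ.*<* ())

∣p-1∣<δ : ∀ {p h δ} → 1ℚ ℚ.- h ℚ.≤ p → p ℚ.≤ 1ℚ → h ℚ.< δ → ℚ.∣ p ℚ.- 1ℚ ∣ ℚ.< δ
∣p-1∣<δ {p} {h} {δ} 1-h≤p p≤1 h<δ = begin-strict
  ℚ.∣ p ℚ.- 1ℚ ∣        ≡⟨ ℚₚ.∣-p∣≡∣p∣ (p ℚ.- 1ℚ) ⟨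
  ℚ.∣ ℚ.- (p ℚ.- 1ℚ) ∣  ≡⟨ cong ℚ.∣_∣ (⁻¹-anti-homo‿- p 1ℚ) ⟩
  ℚ.∣ 1ℚ ℚ.- p ∣        ≡⟨ ℚₚ.0≤p⇒∣p∣≡p 0≤1-p ⟩
  1ℚ ℚ.- p              ≤⟨ ℚₚ.+-monoʳ-≤ 1ℚ (ℚₚ.neg-antimono-≤ 1-h≤p) ⟩
  1ℚ ℚ.- (1ℚ ℚ.- h)     ≡⟨ cong (1ℚ ℚ.+_) (⁻¹-anti-homo‿- 1ℚ h) ⟩
  1ℚ ℚ.+ (h ℚ.- 1ℚ)     ≡⟨ ℚₚ.+-comm 1ℚ (h ℚ.- 1ℚ) ⟩
  h ℚ.- 1ℚ ℚ.+ 1ℚ       ≡⟨ ℚₚ.+-assoc h (ℚ.- 1ℚ) 1ℚ ⟩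
  h ℚ.+ 0ℚ              ≡⟨ ℚₚ.+-identityʳ h ⟩
  h                     <⟨ h<δ ⟩
  δ                     ∎
  where
  open ℚₚ.≤-Reasoning
  0≤1-p : 0ℚ ℚ.≤ 1ℚ ℚ.- p
  0≤1-p = subst (ℚ._≤ 1ℚ ℚ.- p) (ℚₚ.+-inverseʳ p) (ℚₚ.+-monoˡ-≤ (ℚ.- p) p≤1)

mainTheorem10 : ∀ (m : ℕ) → 2 ℕ.≤ m →
    LiminfPositive (λ n → Prob (G m n) (λ g → 𝒯 g ℕ.≟ n))
    × (∀ (ω : ℕ → ℤ) → TendsTo∞ ω → IsLittleO-n ω →
    ∃[ ε ] (ε ⟶ 0ℚ
    × (λ n → Prob (G m n) (λ g → (1ℚ ℚ.- ε n) ℚ.* ratio n (ω n) ℚ.≤? (+ 𝒯 g ℚ./ 1))) ⟶ 1ℚ))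
-- For part (i) the constant is `1 - 1/2`, valid from `n = 0` on; for part (ii) the error `ε` is
-- identically 0.
mainTheorem10 m 2≤m = (1ℚ ℚ.- halfInv 0 , ℚ.*<* (ℤ.+<+ (ℕ.s≤s ℕ.z≤n)) , 0 , λ n _ → spanning n) , λ ω ω→∞ _ →
  (λ _ → 0ℚ) , (λ δ 0<δ → 0 , λ _ _ → 0<δ) , linear ω ω→∞
  where
  spanning : ∀ n → 1ℚ ℚ.- halfInv 0 ℚ.≤ Prob (G m n) (λ g → 𝒯 g ℕ.≟ n)
  -- For `w = 1` all vertices share the root 0, and `n ≤ 𝒯 g` meets the trivial upper bound.
  spanning n = Prob-≥ 2≤m 0 n (λ g → 𝒯 g ℕ.≟ n) λ g n≤ →
    ℕₚ.≤-antisym (largest-≤ (hasRecursiveTree? g) n) (subst (n ℕ.≤_) (ℕₚ.*-identityˡ (𝒯 g)) n≤)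

  1-0≡1 : 1ℚ ℚ.- 0ℚ ≡ 1ℚ
  1-0≡1 = refl

  ratio≤ : ∀ n k T → n ℕ.≤ suc k ℕ.* T → (1ℚ ℚ.- 0ℚ) ℚ.* ratio n +[1+ k ] ℚ.≤ + T ℚ./ 1
  ratio≤ n k T n≤ = ℚₚ.≤-trans
    (ℚₚ.≤-reflexive (trans (cong (ℚ._* ratio n +[1+ k ]) 1-0≡1) (ℚₚ.*-identityˡ (ratio n +[1+ k ]))))
    (/-mono-≤ {n} {suc k} {T} {1} (subst₂ ℕ._≤_ (sym (ℕₚ.*-identityʳ n)) (ℕₚ.*-comm (suc k) T) n≤))

  large? : ∀ n z → Decidable (λ (g : Multigraph n) → (1ℚ ℚ.- 0ℚ) ℚ.* ratio n z ℚ.≤ + 𝒯 g ℚ./ 1)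
  large? n z g = (1ℚ ℚ.- 0ℚ) ℚ.* ratio n z ℚ.≤? (+ 𝒯 g ℚ./ 1)

  close : ∀ {δ K} → (∀ k → K ℕ.≤ k → halfInv k ℚ.< δ) →
    ∀ n z → + suc K ℤ.≤ z → ℚ.∣ Prob (G m n) (large? n z) ℚ.- 1ℚ ∣ ℚ.< δ
  -- An integer that is at least `suc K` is positive, so `ratio` takes its genuine branch and `w` is
  -- `suc k`.
  close small n +[1+ k ] (ℤ.+≤+ K≤k) =
    ∣p-1∣<δ (Prob-≥ 2≤m k n (large? n +[1+ k ]) λ g → ratio≤ n k (𝒯 g)) (Prob-≤1 m n (large? n +[1+ k ])) (small k (ℕₚ.≤-pred K≤k))

  linear : ∀ ω → TendsTo∞ ω → (λ n → Prob (G m n) (large? n (ω n))) ⟶ 1ℚ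
  linear ω ω→∞ δ 0<δ =
    let K , small = halfInv-small δ 0<δ
        -- The shift by one matches the bound `halfInv k` for `ω n = suc k`: it yields `K ≤ k`.
        N , K≤ω = ω→∞ (+ suc K)
    in N , λ n N≤n → close small n (ω n) (K≤ω n N≤n)
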